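{- Let $r\ge 1$ and let $\ell_1,\dots,\ell_r$ be positive integers. Let $c\colon E(\vec{K}_{\mathbb{N}})\to\{1,\dots,r+1\}$ be an edge-colouring of $\vec{K}_{\mathbb{N}}$ such that for every $i\in\{1,\dots,r\}$ there is no directed path of length $\ell_i$ all of whose edges have colour $i$. Moreover, assume that every directed path all of whose edges have colour $r+1$ has upper density at most $\prod_{i=1}^{r}\frac{1}{\ell_i}$. Then there exist a cube partition $\mathcal{U}$ of $\mathbb{N}$ of order $(\ell_1,\dots,\ell_r)$, each of whose partition classes has upper density $\prod_{i=1}^r\frac1{\ell_i}$, and a finite set $F\subseteq\mathbb{N}$ such that $c_{\mathcal{U}}=c$ on $D_{\mathcal{U}}-F$; that is, $c(m,n)=c_{\mathcal{U}}(m,n)$ for every edge $(m,n)$ of the slide digraph $D_{\mathcal{U}}$ with $m,n\notin F$, where $c_{\mathcal{U}}$ is the cube colouring associated with $\mathcal{U}$.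
   Context: $\mathbb{N}$ denotes the positive integers. $\vec{K}_{\mathbb{N}}$ is the complete symmetric digraph on $\mathbb{N}$: its edges are all ordered pairs $(m,n)$ of distinct positive integers. The upper density of $A\subseteq\mathbb{N}$ is $\bar d(A)=\limsup_{n\to\infty}\frac{|A\cap\{1,\dots,n\}|}{n}$, and the upper density of a path is that of its vertex set. A directed path is a finite or one-way infinite sequence of distinct vertices $v_1v_2\dots$ together with edges joining consecutive vertices, all oriented in the same direction (all edges $(v_i,v_{i+1})$, or all edges $(v_{i+1},v_i)$). The length of a path is its number of edges. Cube partition: a cube partition of $\mathbb{N}$ of order $(\ell_1,\dots,\ell_r)$ is a partition $\mathcal{U}=(U_{i_1,\dots,i_r})$ of $\mathbb{N}$ indexed by the tuples $(i_1,\dots,i_r)\in\prod_{k=1}^r\{0,\dots,\ell_k-1\}$. Cube colouring: for a cube partition $\mathcal{U}$, the colouring $c_{\mathcal{U}}\colon E(\vec{K}_{\mathbb{N}})\to\{1,\dots,r+1\}$ is defined as follows. If $m\neq n$ lie in the same class of $\mathcal{U}$, then $(m,n)$ and $(n,m)$ both get colour $r+1$. If $m\in U_{i_1,\dots,i_r}$ and $n\in U_{j_1,\dots,j_r}$ lie in different classes, let $k=\min\{k'\in\{1,\dots,r\}: i_{k'}\neq j_{k'}\}$ and name $m,n$ so that $i_k<j_k$; then $(m,n)$ gets colour $r+1$ and $(n,m)$ gets colour $k$. Slide digraph: for a cube partition $\mathcal{U}$, $D_{\mathcal{U}}$ is the digraph on $\mathbb{N}$ in which a pair $(m,n)$ of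 distinct integers $m\in U_{i_1,\dots,i_r}$, $n\in U_{j_1,\dots,j_r}$ is an edge if and only if either (1) there is an index $k$ such that $i_k>j_k$ and $i_{k'}=j_{k'}$ for all $k'\neq k$, or (2) $i_k\le j_k$ for every $k\in\{1,\dots,r\}$. -}

module Defs where

open import Axiom.ExcludedMiddle using (ExcludedMiddle)
open import Data.Fin.Base as Fin using (Fin; zero; suc; inject₁; fromℕ)
import Data.Fin.Properties as Fin
open import Data.Integer.Base using (+_)
open import Data.List.Base using (length; filter; upTo)
open import Data.Nat.Base as ℕ using (ℕ; suc; NonZero)
open import Data.Product.Base using (Σ-syntax; ∃-syntax; _×_; proj₁)
open import Data.Rational.Base using (ℚ; 0ℚ; 1ℚ; _/_; _+_; _-_; _*_; _≤_; _<_)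
import Data.Vec.Functional as Vector
open import Data.Sum.Base using (_⊎_)
open import Function.Definitions using (Injective)
open import Level using (0ℓ)
open import Relation.Binary.Core using (Rel)
open import Relation.Binary.PropositionalEquality using (_≡_; _≢_)
open import Relation.Nullary.Decidable using (yes; no)
open import Relation.Unary using (Pred)

-- The vertices are the positive integers: v : Vertex stands for the integer
-- suc v.

Vertex : Set
Vertex = ℕ

-- The distinctness proof is irrelevant, so that a colour depends only on the
-- ordered pair.

EdgeColouring : Set → Set
EdgeColouring C = (m n : Vertex) → .(m ≢ n) → C

-- Colour i ∈ {1,…,r} is boundedColour of the k : Fin r with toℕ k = i - 1, and
-- colour r + 1 is lastColour r.

Colour : ℕ → Set
Colour r = Fin (suc r)

boundedColour : ∀ {r} → Fin r → Colour r
boundedColour = inject₁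

lastColour : ∀ r → Colour r
lastColour = fromℕ

EdgeOfColour : ∀ {C} → EdgeColouring C → C → Rel Vertex 0ℓ
EdgeOfColour c k m n = Σ[ m≢n ∈ m ≢ n ] c m n m≢n ≡ k

-- Directed paths in the digraph with edge relation E. The index L of a finite
-- path is its length, i.e. its number of edges.

record FinitePath (E : Rel Vertex 0ℓ) (L : ℕ) : Set where
  field
    vertex   : Fin (suc L) → Vertex
    distinct : Injective _≡_ _≡_ vertex
    directed : (∀ (i : Fin L) → E (vertex (inject₁ i)) (vertex (suc i)))
             ⊎ (∀ (i : Fin L) → E (vertex (suc i)) (vertex (inject₁ i)))

record InfinitePath (E : Rel Vertex 0ℓ) : Set where
  field
    vertex   : ℕ → Vertex
    distinct : Injective _≡_ _≡_ vertex
    directed : (∀ i → E (vertex i) (vertex (suc i)))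
             ⊎ (∀ i → E (vertex (suc i)) (vertex i))

data DirectedPath (E : Rel Vertex 0ℓ) : Set where
  finite   : ∀ {L} → FinitePath E L → DirectedPath E
  infinite : InfinitePath E → DirectedPath E

vertexSet : ∀ {E} → DirectedPath E → Pred Vertex 0ℓ
vertexSet (finite P)   v = ∃[ i ] FinitePath.vertex P i ≡ v
vertexSet (infinite P) v = ∃[ i ] InfinitePath.vertex P i ≡ v

-- Comparison of the limit superior of a rational sequence, a real number in
-- general, with a rational number x.

LimSup_≤_ : (ℕ → ℚ) → ℚ → Set
LimSup a ≤ x = ∀ ε → 0ℚ < ε → ∃[ N ] (∀ n → N ℕ.≤ n → a n ≤ x + ε)

LimSup_≥_ : (ℕ → ℚ) → ℚ → Set
LimSup a ≥ x = ∀ ε → 0ℚ < ε → ∀ N → ∃[ n ] (N ℕ.≤ n × x - ε ≤ a n)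

-- Excluded middle is what makes it possible to count the elements of an
-- arbitrary subset.

module _ (em : ExcludedMiddle 0ℓ) where

  -- |A ∩ {1,…,suc n}|; under the encoding of vertices, {1,…,suc n} consists of
  -- 0,…,n.
  initialCount : Pred Vertex 0ℓ → ℕ → ℕ
  initialCount A n = length (filter (λ v → em {A v}) (upTo (suc n)))

  initialDensity : Pred Vertex 0ℓ → ℕ → ℚ
  initialDensity A n = + initialCount A n / suc n

  UpperDensityAtMost : Pred Vertex 0ℓ → ℚ → Set
  UpperDensityAtMost A x = LimSup (initialDensity A) ≤ x

  UpperDensityEquals : Pred Vertex 0ℓ → ℚ → Set
  UpperDensityEquals A x =
    LimSup (initialDensity A) ≤ x × LimSup (initialDensity A) ≥ x

productOfReciprocals : ∀ {r} (ℓ : Fin r → ℕ) → (∀ k → NonZero (ℓ k)) → ℚ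
productOfReciprocals ℓ ℓ≢0 =
  Vector.foldr _*_ 1ℚ (λ k → _/_ (+ 1) (ℓ k) {{ℓ≢0 k}})

module _ {r : ℕ} (ℓ : Fin r → ℕ) where

  Index : Set
  Index = (k : Fin r) → Fin (ℓ k)

  -- A partition is encoded by the map sending each vertex to the index of the
  -- class containing it. Indices are compared pointwise.
  CubePartition : Set
  CubePartition = Vertex → Index

module _ {r : ℕ} {ℓ : Fin r → ℕ} (U : CubePartition ℓ) where

  class : Index ℓ → Pred Vertex 0ℓ
  class t v = ∀ k → U v k ≡ t k

  cubeColouring : EdgeColouring (Colour r)
  cubeColouring m n _ with Fin.all? (λ k → U m k Fin.≟ U n k)
  ... | yes _ = lastColour r
  ... | no differ
        with k ← proj₁ (Fin.¬∀⟶∃¬-smallest r _ (λ k → U m k Fin.≟ U n k) differ)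
        with U m k Fin.<? U n k
  ...   | yes _ = lastColour r
  ...   | no  _ = boundedColour k

  SlideEdge : Rel Vertex 0ℓ
  SlideEdge m n = m ≢ n ×
    ( (∃[ k ] (U m k Fin.> U n k × (∀ k′ → k′ ≢ k → U m k′ ≡ U n k′)))
    ⊎ (∀ k → U m k Fin.≤ U n k) )

{-# OPTIONS --safe #-}
module Submission where

-- Gallai–Roy, applied to each bounded colour k, gives a proper colouring with ℓ k values of the
-- digraph of colour k; together these form a partition W into Π ℓ cliques of colour r + 1. A clique
-- is swept by a path, so each class has upper density at most 1/Π ℓ, and as the classes are only
-- Π ℓ in number, each has density exactly 1/Π ℓ. If arbitrarily late edges of colour r + 1 ran both
-- ways between two classes, one path would sweep both, with density 2/Π ℓ; hence beyond some N
-- one of the two directions carries bounded colours only. On a line of classes of W in direction k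
-- that colour has to be k, so Rédei's theorem orders the ℓ k classes into a path of complete
-- bipartite digraphs of colour k.
--
-- Let U v k be the number of classes after that of v on its line. An edge u → v of colour k
-- prolongs the classes before u and is prolonged by the classes after v, so the bound on
-- paths of colour k yields U v k < U u k. Thus U-ascending edges have colour r + 1, and U is
-- again a partition into cliques beyond N. Repeating the argument for U: between two classes that
-- differ only in direction k the ascending edges all have colour r + 1, so the descending ones
-- have bounded colours eventually, and that colour can only be k.

open import Defs
open import Axiom.ExcludedMiddle using (ExcludedMiddle)
open import Data.Empty using (⊥)
open import Data.Fin.Base as Fin using (Fin; zero; suc; toℕ; inject₁; fromℕ<; combine; punchIn; punchOut)
import Data.Fin.Properties as Fin
import Data.Fin.Relation.Unary.Top as Top
open import Data.Integer.Base as ℤ using (+_)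
import Data.Integer.Properties as ℤ
open import Data.List.Base using (List; []; _∷_; [_]; _++_; length; filter; allFin; upTo; initLast; _∷ʳ′_)
open import Data.List.Properties
  using (length-++; length-filter; filter-++; upTo-∷ʳ; length-upTo; length-tabulate; ++-assoc; ++-identityʳ)
open import Data.List.Membership.Propositional using (_∈_; _∉_)
open import Data.List.Membership.Propositional.Properties using (∈-++⁺ʳ; ∈-allFin; ∈-upTo⁺)
open import Data.List.Relation.Binary.Permutation.Propositional
  using (_↭_; ↭-refl; ↭-sym; ↭-trans; prep; swap)
open import Data.List.Relation.Binary.Permutation.Propositional.Properties
  using (All-resp-↭; ∈-resp-↭; ↭-length)
open import Data.List.Relation.Unary.All as All using (All; []; _∷_)
import Data.List.Relation.Unary.All.Properties as All
open import Data.List.Relation.Unary.AllPairs as AllPairs using (AllPairs; []; _∷_)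
open import Data.List.Relation.Unary.Any using (here; there)
open import Data.List.Relation.Unary.Linked as Linked using (Linked; []; [-]; _∷_)
open import Data.List.Relation.Unary.Unique.Propositional using (Unique)
import Data.List.Relation.Unary.Unique.Propositional.Properties as Unique
open import Data.Nat.Base
open import Data.Nat.Properties
open import Data.Nat.Tactic.RingSolver using (solve-∀)
open import Data.List.Membership.DecPropositional _≟_ using (_∈?_)
open import Data.Product.Base using (Σ; Σ-syntax; ∃-syntax; _×_; _,_; proj₁; proj₂; map₂)
import Data.Rational.Base as ℚ
import Data.Rational.Properties as ℚ
import Data.Rational.Unnormalised.Base as ℚᵘ
import Data.Rational.Unnormalised.Properties as ℚᵘ
open import Data.Sum.Base using (_⊎_; inj₁; inj₂)
open import Data.Unit.Base using (⊤)
import Data.Vec.Functional as Vector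
open import Function.Base using (_∘_; flip; id; it)
open import Function.Bundles using (Equivalence; _⇔_; mk⇔)
open import Level using (0ℓ)
open import Relation.Binary.Construct.Closure.ReflexiveTransitive as Star using (Star; ε; _◅_; _◅◅_)
open import Relation.Binary.Core using (Rel)
open import Relation.Binary.Definitions using (tri<; tri≈; tri>)
open import Relation.Binary.PropositionalEquality
  using (_≡_; _≢_; refl; sym; trans; cong; cong₂; subst; subst₂)
open import Relation.Nullary.Decidable using (Dec; yes; no)
open import Relation.Nullary.Negation using (¬_; contradiction)
open import Relation.Unary using (Pred; ⋃)

-- Densities

toℚᵘ-/ : ∀ a b .{{_ : NonZero b}} → ℚ.toℚᵘ (+ a ℚ./ b) ℚᵘ.≃ (+ a ℚᵘ./ b)
toℚᵘ-/ a (suc b) = ℚ.toℚᵘ-fromℚᵘ (ℚᵘ.mkℚᵘ (+ a) b)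

-- Both density bounds compare one fraction with a sum of two: a count over `suc n` with 1/P + 1/q,
-- or 1/P with such a fraction plus 1/q. Clearing denominators in this shape serves both.
/≤/+/⇔≤ᵘ : ∀ a b d x y z .{{_ : NonZero x}} .{{_ : NonZero y}} .{{_ : NonZero z}} →
  ((+ a ℚᵘ./ x) ℚᵘ.≤ (+ b ℚᵘ./ y) ℚᵘ.+ (+ d ℚᵘ./ z)) ⇔ (a * (y * z) ≤ (b * z + d * y) * x)
/≤/+/⇔≤ᵘ a b d (suc x) (suc y) (suc z) = mk⇔
  (λ { (ℚᵘ.*≤* p) → ℤ.drop‿+≤+ (subst₂ ℤ._≤_ lhs rhs p) })
  (λ le → ℚᵘ.*≤* (subst₂ ℤ._≤_ (sym lhs) (sym rhs) (ℤ.+≤+ le)))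
  where
  lhs : + a ℤ.* + (suc y * suc z) ≡ + (a * (suc y * suc z))
  lhs = sym (ℤ.pos-* a (suc y * suc z))
  rhs : (+ b ℤ.* + suc z ℤ.+ + d ℤ.* + suc y) ℤ.* + suc x ≡ + ((b * suc z + d * suc y) * suc x)
  rhs = trans (cong (ℤ._* + suc x) (cong₂ ℤ._+_ (sym (ℤ.pos-* b (suc z))) (sym (ℤ.pos-* d (suc y)))))
              (sym (ℤ.pos-* (b * suc z + d * suc y) (suc x)))

module _ (a b d x y z : ℕ) .{{_ : NonZero x}} .{{_ : NonZero y}} .{{_ : NonZero z}} where

  private
    toℚᵘ-sum : ℚ.toℚᵘ (+ b ℚ./ y ℚ.+ + d ℚ./ z) ℚᵘ.≃ (+ b ℚᵘ./ y) ℚᵘ.+ (+ d ℚᵘ./ z)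
    toℚᵘ-sum = ℚᵘ.≃-trans (ℚ.toℚᵘ-homo-+ (+ b ℚ./ y) (+ d ℚ./ z))
                          (ℚᵘ.+-cong (toℚᵘ-/ b y) (toℚᵘ-/ d z))

  /≤/+/⇒≤ : + a ℚ./ x ℚ.≤ + b ℚ./ y ℚ.+ + d ℚ./ z → a * (y * z) ≤ (b * z + d * y) * x
  /≤/+/⇒≤ = Equivalence.to (/≤/+/⇔≤ᵘ a b d x y z) ∘
    ℚᵘ.≤-respˡ-≃ (toℚᵘ-/ a x) ∘ ℚᵘ.≤-respʳ-≃ toℚᵘ-sum ∘ ℚ.toℚᵘ-mono-≤

  ≤⇒/≤/+/ : a * (y * z) ≤ (b * z + d * y) * x → + a ℚ./ x ℚ.≤ + b ℚ./ y ℚ.+ + d ℚ./ z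
  ≤⇒/≤/+/ = ℚ.toℚᵘ-cancel-≤ ∘ ℚᵘ.≤-respˡ-≃ (ℚᵘ.≃-sym (toℚᵘ-/ a x)) ∘
    ℚᵘ.≤-respʳ-≃ (ℚᵘ.≃-sym toℚᵘ-sum) ∘ Equivalence.from (/≤/+/⇔≤ᵘ a b d x y z)

1/*1/ : ∀ a b .{{_ : NonZero a}} .{{_ : NonZero b}} .{{_ : NonZero (a * b)}} →
        (+ 1 ℚ./ a) ℚ.* (+ 1 ℚ./ b) ≡ + 1 ℚ./ (a * b)
1/*1/ (suc a) (suc b) = ℚ.toℚᵘ-injective (ℚᵘ.≃-trans
  (ℚ.toℚᵘ-homo-* (+ 1 ℚ./ suc a) (+ 1 ℚ./ suc b))
  (ℚᵘ.≃-trans (ℚᵘ.*-cong (toℚᵘ-/ 1 (suc a)) (toℚᵘ-/ 1 (suc b)))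
              (ℚᵘ.≃-sym (toℚᵘ-/ 1 (suc a * suc b)))))

Π : ∀ {r} → (Fin r → ℕ) → ℕ
Π = Vector.foldr _*_ 1

Π-nonZero : ∀ {r} (ℓ : Fin r → ℕ) → (∀ k → NonZero (ℓ k)) → NonZero (Π ℓ)
Π-nonZero {zero}  ℓ ℓ≢0 = _
Π-nonZero {suc r} ℓ ℓ≢0 =
  m*n≢0 (ℓ zero) (Π (ℓ ∘ suc)) {{ℓ≢0 zero}} {{Π-nonZero (ℓ ∘ suc) (ℓ≢0 ∘ suc)}}

productOfReciprocals≡1/Π : ∀ {r} (ℓ : Fin r → ℕ) (ℓ≢0 : ∀ k → NonZero (ℓ k)) →
  productOfReciprocals ℓ ℓ≢0 ≡ ℚ._/_ (+ 1) (Π ℓ) {{Π-nonZero ℓ ℓ≢0}}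
productOfReciprocals≡1/Π {zero}  ℓ ℓ≢0 = refl
productOfReciprocals≡1/Π {suc r} ℓ ℓ≢0 = trans
  (cong ((ℚ._/_ (+ 1) (ℓ zero) {{ℓ≢0 zero}}) ℚ.*_)
        (productOfReciprocals≡1/Π (ℓ ∘ suc) (ℓ≢0 ∘ suc)))
  (1/*1/ (ℓ zero) (Π (ℓ ∘ suc)) {{ℓ≢0 zero}} {{Π-nonZero (ℓ ∘ suc) (ℓ≢0 ∘ suc)}} {{Π-nonZero ℓ ℓ≢0}})

0<1/ : ∀ q .{{_ : NonZero q}} → ℚ.0ℚ ℚ.< + 1 ℚ./ q
0<1/ (suc q) = ℚ.positive⁻¹ (+ 1 ℚ./ suc q) {{ℚ.normalize-pos 1 (suc q)}}

-- The reciprocal of the denominator of `δ` works, as the numerator is at least 1. Every ε may thus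
-- be replaced by some 1/q.
1/-below : ∀ δ → ℚ.0ℚ ℚ.< δ → Σ[ q ∈ ℕ ] Σ[ q≢0 ∈ NonZero q ] (ℚ._/_ (+ 1) q {{q≢0}} ℚ.≤ δ)
1/-below (ℚ.mkℚ (+ 0)      d _) 0<δ with ℚ.drop-*<* 0<δ
... | ℤ.+<+ ()
1/-below (ℚ.mkℚ ℤ.-[1+ n ] d _) 0<δ with ℚ.drop-*<* 0<δ
... | ()
1/-below (ℚ.mkℚ ℤ.+[1+ n ] d _) 0<δ = suc d , _ ,
  ℚ.toℚᵘ-cancel-≤ (ℚᵘ.≤-respˡ-≃ (ℚᵘ.≃-sym (toℚᵘ-/ 1 (suc d)))
    (ℚᵘ.*≤* (ℤ.*-monoʳ-≤-nonNeg (+ suc d) {x = + 1} {y = + suc n} (ℤ.+≤+ (s≤s z≤n)))))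

module _ (em : ExcludedMiddle 0ℓ) (P : ℕ) .{{_ : NonZero P}} where

  -- Upper density at most 1/P, with ε = 1/q and denominators cleared.
  Small : Pred Vertex 0ℓ → Set
  Small A = ∀ q .{{_ : NonZero q}} →
    ∃[ N ] (∀ n → N ≤ n → initialCount em A n * (P * q) ≤ (q + P) * suc n)

  1*+1* : ∀ a b → 1 * a + 1 * b ≡ a + b
  1*+1* a b = cong₂ _+_ (*-identityˡ a) (*-identityˡ b)

  atMost⇒Small : ∀ {A} → UpperDensityAtMost em A (+ 1 ℚ./ P) → Small A
  atMost⇒Small {A} h q with h (+ 1 ℚ./ q) (0<1/ q)
  ... | N , bound = N , λ n N≤n →
    ≤-trans (/≤/+/⇒≤ (initialCount em A n) 1 1 (suc n) P q (bound n N≤n))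
            (≤-reflexive (cong (_* suc n) (1*+1* q P)))

  Small⇒atMost : ∀ {A} → Small A → UpperDensityAtMost em A (+ 1 ℚ./ P)
  Small⇒atMost {A} h δ δ>0 with 1/-below δ δ>0
  ... | q , q≢0 , 1/q≤δ with h q ⦃ q≢0 ⦄
  ...   | N , bound = N , λ n N≤n → ℚ.≤-trans
    (≤⇒/≤/+/ (initialCount em A n) 1 1 (suc n) P q {{_}} {{it}} {{q≢0}}
      (≤-trans (bound n N≤n) (≤-reflexive (cong (_* suc n) (sym (1*+1* q P))))))
    (ℚ.+-monoʳ-≤ (+ 1 ℚ./ P) 1/q≤δ)

  -- The hypothesis is 1/P ≤ count/(n + 1) + 1/q with denominators cleared. It is asked of all large
  -- n, the form in which counting a complement delivers it.
  atLeast : ∀ {A} → (∀ q .{{_ : NonZero q}} → ∃[ N ] (∀ n → N ≤ n →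
              suc n * q ≤ (initialCount em A n * q + suc n) * P)) →
            LimSup (initialDensity em A) ≥ (+ 1 ℚ./ P)
  atLeast {A} h δ δ>0 M with 1/-below δ δ>0
  ... | q , q≢0 , 1/q≤δ with h q ⦃ q≢0 ⦄
  ...   | N , bound = n , m≤m⊔n M N , (begin
    + 1 ℚ./ P ℚ.- δ             ≤⟨ ℚ.+-monoˡ-≤ (ℚ.- δ) 1/P≤d+δ ⟩
    d ℚ.+ δ ℚ.- δ               ≡⟨ ℚ.+-assoc d δ (ℚ.- δ) ⟩
    d ℚ.+ (δ ℚ.- δ)             ≡⟨ cong (d ℚ.+_) (ℚ.+-inverseʳ δ) ⟩
    d ℚ.+ ℚ.0ℚ                  ≡⟨ ℚ.+-identityʳ d ⟩
    d                           ∎)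
    where
    open ℚ.≤-Reasoning
    n : ℕ
    n = M ⊔ N
    d : ℚ.ℚ
    d = initialDensity em A n
    1/P≤d+δ : + 1 ℚ./ P ℚ.≤ d ℚ.+ δ
    1/P≤d+δ = ℚ.≤-trans
      (≤⇒/≤/+/ 1 (initialCount em A n) 1 P (suc n) q {{it}} {{_}} {{q≢0}}
        (subst₂ (λ x y → x ≤ (initialCount em A n * q + y) * P)
          (sym (*-identityˡ (suc n * q))) (sym (*-identityˡ (suc n))) (bound n (m≤n⊔m M N))))
      (ℚ.+-monoʳ-≤ d 1/q≤δ)

-- Counting

eventually-all : ∀ {Q} (T : Fin Q → ℕ → Set) →
  (∀ p → ∃[ N ] (∀ n → N ≤ n → T p n)) → ∃[ N ] (∀ n → N ≤ n → ∀ p → T p n)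
eventually-all {zero}  T h = 0 , λ _ _ ()
eventually-all {suc Q} T h
  with N , hN ← h zero | M , hM ← eventually-all (T ∘ suc) (h ∘ suc)
  = N ⊔ M , λ n le → λ where
      zero    → hN n (≤-trans (m≤m⊔n N M) le)
      (suc p) → hM n (≤-trans (m≤n⊔m N M) le) p

module _ (em : ExcludedMiddle 0ℓ) where

  count : Pred Vertex 0ℓ → List Vertex → ℕ
  count A xs = length (filter (λ v → em {A v}) xs)

  count-∪ : ∀ A B C → (∀ v → A v → B v ⊎ C v) → ∀ xs → count A xs ≤ count B xs + count C xs
  count-∪ A B C A⊆B∪C []       = z≤n
  count-∪ A B C A⊆B∪C (x ∷ xs) with count-∪ A B C A⊆B∪C xs | em {A x} | em {B x} | em {C x}
  ... | ih | no  _ | no  _ | no  _ = ih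
  ... | ih | no  _ | yes _ | no  _ = m≤n⇒m≤1+n ih
  ... | ih | no  _ | no  _ | yes _ = ≤-trans ih (+-monoʳ-≤ _ (n≤1+n _))
  ... | ih | no  _ | yes _ | yes _ = m≤n⇒m≤1+n (≤-trans ih (+-monoʳ-≤ _ (n≤1+n _)))
  ... | ih | yes _ | yes _ | no  _ = s≤s ih
  ... | ih | yes _ | yes _ | yes _ = s≤s (≤-trans ih (+-monoʳ-≤ _ (n≤1+n _)))
  ... | ih | yes _ | no  _ | yes _ = ≤-trans (s≤s ih) (≤-reflexive (sym (+-suc _ _)))
  ... | ih | yes a | no ¬b | no ¬c with A⊆B∪C x a
  ...   | inj₁ b = contradiction b ¬b
  ...   | inj₂ c = contradiction c ¬c

  count-++ : ∀ A xs ys → count A (xs ++ ys) ≡ count A xs + count A ys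
  count-++ A xs ys =
    trans (cong length (filter-++ A? xs ys)) (length-++ (filter A? xs))
    where
    A? : ∀ v → Dec (A v)
    A? v = em

  count-< : ∀ N n → count (_< N) (upTo n) ≤ N
  count-< N zero    = z≤n
  count-< N (suc n) with n <? N
  ... | yes n<N = ≤-trans (length-filter (λ v → em {v < N}) (upTo (suc n)))
                          (≤-trans (≤-reflexive (length-upTo (suc n))) n<N)
  ... | no  n≮N = begin
    count (_< N) (upTo (suc n))                      ≡⟨ cong (count (_< N)) (upTo-∷ʳ n) ⟨
    count (_< N) (upTo n ++ [ n ])                   ≡⟨ count-++ (_< N) (upTo n) [ n ] ⟩
    count (_< N) (upTo n) + count (_< N) [ n ]       ≡⟨ cong (λ k → count (_< N) (upTo n) + k) none ⟩
    count (_< N) (upTo n) + 0                        ≡⟨ +-identityʳ _ ⟩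
    count (_< N) (upTo n)                            ≤⟨ count-< N n ⟩
    N                                                ∎
    where
    open ≤-Reasoning
    none : count (_< N) [ n ] ≡ 0
    none with em {n < N}
    ... | yes n<N = contradiction n<N n≮N
    ... | no  _   = refl

  initialCount-⊆ : ∀ A B N → (∀ v → N ≤ v → A v → B v) →
                   ∀ n → initialCount em A n ≤ N + initialCount em B n
  initialCount-⊆ A B N A⊆B n = ≤-trans
    (count-∪ A (_< N) B split (upTo (suc n)))
    (+-monoˡ-≤ (initialCount em B n) (count-< N (suc n)))
    where
    split : ∀ v → A v → v < N ⊎ B v
    split v a with v <? N
    ... | yes v<N = inj₁ v<N
    ... | no  v≮N = inj₂ (A⊆B v (≮⇒≥ v≮N) a)

  count-all : ∀ A → (∀ v → A v) → ∀ xs → count A xs ≡ length xs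
  count-all A all []       = refl
  count-all A all (x ∷ xs) with em {A x}
  ... | yes _  = cong suc (count-all A all xs)
  ... | no  ¬a = contradiction (all x) ¬a

  count-none : ∀ A → (∀ v → ¬ A v) → ∀ xs → count A xs ≡ 0
  count-none A none []       = refl
  count-none A none (x ∷ xs) with em {A x}
  ... | yes a = contradiction a (none x)
  ... | no  _ = count-none A none xs

  initialCount-all : ∀ A → (∀ v → A v) → ∀ n → initialCount em A n ≡ suc n
  initialCount-all A all n = trans (count-all A all (upTo (suc n))) (length-upTo (suc n))

  count-⋃ : ∀ {Q} (A : Fin Q → Pred Vertex 0ℓ) xs a b → (∀ p → count (A p) xs * a ≤ b) →
            count (⋃ _ A) xs * a ≤ Q * b
  count-⋃ {zero}  A xs a b h = ≤-reflexive (cong (_* a) (count-none (⋃ _ A) (λ _ ()) xs))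
  count-⋃ {suc Q} A xs a b h = begin
    count (⋃ _ A) xs * a
      ≤⟨ *-monoˡ-≤ a (count-∪ (⋃ _ A) (A zero) (⋃ _ (A ∘ suc)) split xs) ⟩
    (count (A zero) xs + count (⋃ _ (A ∘ suc)) xs) * a
      ≡⟨ *-distribʳ-+ a (count (A zero) xs) _ ⟩
    count (A zero) xs * a + count (⋃ _ (A ∘ suc)) xs * a
      ≤⟨ +-mono-≤ (h zero) (count-⋃ (A ∘ suc) xs a b (h ∘ suc)) ⟩
    b + Q * b ∎
    where
    open ≤-Reasoning
    split : ∀ v → ⋃ _ A v → A zero v ⊎ ⋃ _ (A ∘ suc) v
    split v (zero  , a) = inj₁ a
    split v (suc p , a) = inj₂ (p , a)

  module _ (P : ℕ) .{{_ : NonZero P}} where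

    Small-⋃ : ∀ {Q} (A : Fin Q → Pred Vertex 0ℓ) → (∀ p → Small em P (A p)) →
      ∀ q .{{_ : NonZero q}} → ∃[ N ] (∀ n → N ≤ n →
        initialCount em (⋃ _ A) n * (P * q) ≤ Q * ((q + P) * suc n))
    Small-⋃ A small q
      with N , hN ← eventually-all (λ p n → initialCount em (A p) n * (P * q) ≤ (q + P) * suc n)
                                   (λ p → small p q)
      = N , λ n N≤n → count-⋃ A (upTo (suc n)) (P * q) _ (hN n N≤n)

    Small-⊆ : ∀ A B N → (∀ v → N ≤ v → A v → B v) → Small em P B → Small em P A
    Small-⊆ A B N A⊆B small q
      -- Half of the error 1/q goes to `B`, hence 2q; the other half absorbs the at most `N`
      -- vertices below `N` once n + 1 ≥ 2Nq.
      with M , hM ← small (2 * q) {{m*n≢0 2 q}}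
      = M ⊔ (2 * N * q) , λ n le → *-cancelˡ-≤ 2 (begin
          2 * (initialCount em A n * (P * q))
            ≤⟨ *-monoʳ-≤ 2 (*-monoˡ-≤ (P * q) (initialCount-⊆ A B N A⊆B n)) ⟩
          2 * ((N + initialCount em B n) * (P * q))
            ≡⟨ eq₁ N (initialCount em B n) P q ⟩
          2 * N * q * P + initialCount em B n * (P * (2 * q))
            ≤⟨ +-mono-≤ (*-monoˡ-≤ P (≤-trans (m≤n⊔m M (2 * N * q)) (m≤n⇒m≤1+n le)))
                        (hM n (≤-trans (m≤m⊔n M (2 * N * q)) le)) ⟩
          suc n * P + (2 * q + P) * suc n
            ≡⟨ eq₂ (suc n) P q ⟩
          2 * ((q + P) * suc n) ∎)
      where
      open ≤-Reasoning
      eq₁ : ∀ N c P q → 2 * ((N + c) * (P * q)) ≡ 2 * N * q * P + c * (P * (2 * q))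
      eq₁ = solve-∀
      eq₂ : ∀ n P q → n * P + (2 * q + P) * n ≡ 2 * ((q + P) * n)
      eq₂ = solve-∀

    Small-bounded : ∀ A N → (∀ v → A v → v < N) → Small em P A
    Small-bounded A N A<N = Small-⊆ A (λ _ → ⊥) N (λ v N≤v a → <⇒≱ (A<N v a) N≤v)
      (λ q → 0 , λ n _ → ≤-trans (≤-reflexive (cong (_* (P * q)) (count-none (λ _ → ⊥) (λ _ ()) (upTo (suc n))))) z≤n)

  module _ (Q : ℕ) where

    private
      P = suc Q

    -- For q = P², the quantity Q (q + P) falls short of P q by exactly P.
    few-Small-sets-do-not-cover : ∀ N (A : Fin Q → Pred Vertex 0ℓ) → (∀ p → Small em P (A p)) →
      ¬ (∀ v → N ≤ v → ⋃ _ A v)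
    few-Small-sets-do-not-cover N A small cover
      with M , hM ← Small-⋃ P A small (P * P)
      = <-irrefl refl (<-≤-trans (s≤s (m≤n⊔m M (N * (P * P)))) (*-cancelʳ-≤ _ _ P
          (+-cancelʳ-≤ (Q * ((P * P + P) * suc n)) _ _ (begin
            suc n * P + Q * ((P * P + P) * suc n) ≡⟨ eq n Q ⟩
            suc n * (P * (P * P))
              ≡⟨ cong (_* (P * (P * P))) (initialCount-all (λ _ → ⊤) _ n) ⟨
            initialCount em (λ _ → ⊤) n * (P * (P * P))
              ≤⟨ *-monoˡ-≤ (P * (P * P)) (initialCount-⊆ (λ _ → ⊤) (⋃ _ A) N (λ v le _ → cover v le) n) ⟩
            (N + initialCount em (⋃ _ A) n) * (P * (P * P))
              ≡⟨ *-distribʳ-+ (P * (P * P)) N _ ⟩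
            N * (P * (P * P)) + initialCount em (⋃ _ A) n * (P * (P * P))
              ≤⟨ +-mono-≤ (≤-reflexive (eq′ N P)) (hM n (m≤m⊔n M _)) ⟩
            N * (P * P) * P + Q * ((P * P + P) * suc n) ∎))))
      where
      open ≤-Reasoning
      n : ℕ
      n = M ⊔ (N * (P * P))
      eq : ∀ n Q → suc n * suc Q + Q * ((suc Q * suc Q + suc Q) * suc n) ≡ suc n * (suc Q * (suc Q * suc Q))
      eq = solve-∀
      eq′ : ∀ N P → N * (P * (P * P)) ≡ N * (P * P) * P
      eq′ = solve-∀

    -- The `Q` small sets use up at most Q/P of the density, which leaves 1/P for `B`.
    complement-lower-bound : ∀ B (A : Fin Q → Pred Vertex 0ℓ) → (∀ p → Small em P (A p)) →
      (∀ v → B v ⊎ ⋃ _ A v) →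
      ∀ q .{{_ : NonZero q}} → ∃[ N ] (∀ n → N ≤ n →
        suc n * q ≤ (initialCount em B n * q + suc n) * P)
    complement-lower-bound B A small cover q
      -- Errors of 1/(qP) in each of the `Q` sets add up to less than 1/q.
      with N , hN ← Small-⋃ P A small (q * P) {{m*n≢0 q P}}
      = N , λ n N≤n → let b = initialCount em B n in
        *-cancelʳ-≤ _ _ P (+-cancelʳ-≤ (Q * (q * P * suc n)) _ _ (begin
          suc n * q * P + Q * (q * P * suc n) ≡⟨ eq n q Q ⟩
          suc n * (P * (q * P))
            ≡⟨ cong (_* (P * (q * P))) (initialCount-all (λ _ → ⊤) _ n) ⟨
          initialCount em (λ _ → ⊤) n * (P * (q * P))
            ≤⟨ *-monoˡ-≤ (P * (q * P)) (count-∪ (λ _ → ⊤) B (⋃ _ A) (λ v _ → cover v) (upTo (suc n))) ⟩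
          (b + initialCount em (⋃ _ A) n) * (P * (q * P))
            ≡⟨ *-distribʳ-+ (P * (q * P)) b _ ⟩
          b * (P * (q * P)) + initialCount em (⋃ _ A) n * (P * (q * P))
            ≤⟨ +-monoʳ-≤ (b * (P * (q * P))) (hN n N≤n) ⟩
          b * (P * (q * P)) + Q * ((q * P + P) * suc n)
            ≤⟨ m≤m+n _ (P * suc n) ⟩
          b * (P * (q * P)) + Q * ((q * P + P) * suc n) + P * suc n
            ≡⟨ eq′ b n q Q ⟩
          (b * q + suc n) * P * P + Q * (q * P * suc n) ∎))
      where
      open ≤-Reasoning
      eq : ∀ n q Q → suc n * q * suc Q + Q * (q * suc Q * suc n) ≡ suc n * (suc Q * (q * suc Q))
      eq = solve-∀
      eq′ : ∀ b n q Q →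
        b * (suc Q * (q * suc Q)) + Q * ((q * suc Q + suc Q) * suc n) + suc Q * suc n ≡
        (b * q + suc n) * suc Q * suc Q + Q * (q * suc Q * suc n)
      eq′ = solve-∀

-- Sweeping a set by a path

-- A relation instead of a lookup function: an entry keeps its position when the list is prolonged,
-- so positions in different stages of a growing list can be compared without bounds on the index.
data At {A : Set} : List A → ℕ → A → Set where
  here  : ∀ {x xs} → At (x ∷ xs) zero x
  there : ∀ {x y xs i} → At xs i y → At (x ∷ xs) (suc i) y

module _ {A : Set} where

  At-functional : ∀ {xs : List A} {i x y} → At xs i x → At xs i y → x ≡ y
  At-functional here      here      = refl
  At-functional (there p) (there q) = At-functional p q

  At-++ : ∀ {xs : List A} {i x} ys → At xs i x → At (xs ++ ys) i x
  At-++ ys here      = here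
  At-++ ys (there p) = there (At-++ ys p)

  At-total : ∀ {i} (xs : List A) → i < length xs → ∃[ x ] At xs i x
  At-total {zero}  (x ∷ xs) _       = x , here
  At-total {suc i} (x ∷ xs) (s≤s p) = map₂ there (At-total xs p)

  At⇒∈ : ∀ {xs : List A} {i x} → At xs i x → x ∈ xs
  At⇒∈ here      = here refl
  At⇒∈ (there p) = there (At⇒∈ p)

  ∈⇒At : ∀ {xs : List A} {x} → x ∈ xs → ∃[ i ] At xs i x
  ∈⇒At (here refl) = zero , here
  ∈⇒At (there p)   = let i , q = ∈⇒At p in suc i , there q

  At-injective : ∀ {xs : List A} {i j x} → Unique xs → At xs i x → At xs j x → i ≡ j
  At-injective (_ ∷ _) here      here      = refl
  At-injective (d ∷ _) here      (there q) = contradiction refl (All.lookup d (At⇒∈ q))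
  At-injective (d ∷ _) (there p) here      = contradiction refl (All.lookup d (At⇒∈ p))
  At-injective (_ ∷ u) (there p) (there q) = cong suc (At-injective u p q)

  At-Linked : ∀ {R : Rel A 0ℓ} {xs i x y} → Linked R xs → At xs i x → At xs (suc i) y → R x y
  At-Linked (r ∷ _)  here      (there here) = r
  At-Linked (_ ∷ rs) (there p) (there q)    = At-Linked rs p q

  Linked-glue : ∀ {R : Rel A 0ℓ} xs {x zs} →
    Linked R (xs ++ [ x ]) → Linked R (x ∷ zs) → Linked R ((xs ++ [ x ]) ++ zs)
  Linked-glue []            _        ls = ls
  Linked-glue (_ ∷ [])      (r ∷ _)  ls = r ∷ ls
  Linked-glue (_ ∷ y ∷ xs)  (r ∷ rs) ls = r ∷ Linked-glue (y ∷ xs) rs ls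

record ListPath (E : Rel Vertex 0ℓ) (xs : List Vertex) : Set where
  constructor _⊢_
  field
    linked : Linked E xs
    unique : Unique xs

open ListPath

ListPath⇒FinitePath : ∀ {E L xs} → ListPath E xs → L < length xs → FinitePath E L
ListPath⇒FinitePath {E} {L} {xs} p L<xs = record
  { vertex   = proj₁ ∘ v
  ; distinct = λ {i} {j} eq → Fin.toℕ-injective
      (At-injective (unique p) (proj₂ (v i)) (subst (At xs (toℕ j)) (sym eq) (proj₂ (v j))))
  ; directed = inj₁ λ i → At-Linked (linked p)
      (subst (λ n → At xs n (proj₁ (v (inject₁ i)))) (Fin.toℕ-inject₁ i) (proj₂ (v (inject₁ i)))) (proj₂ (v (suc i)))
  }
  where
  v : ∀ (i : Fin (suc L)) → ∃[ x ] At xs (toℕ i) x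
  v i = At-total xs (<-≤-trans (Fin.toℕ<n i) L<xs)

ListPath-length : ∀ {E L} → ¬ FinitePath E L → ∀ {xs} → ListPath E xs → length xs ≤ L
ListPath-length none {xs} p = ≮⇒≥ (none ∘ ListPath⇒FinitePath p)

above : (xs : List Vertex) → ∃[ N ] All (_< N) xs
above []       = 0 , []
above (x ∷ xs) = let N , h = above xs in
  suc x ⊔ N , m≤m⊔n (suc x) N ∷ All.map (λ lt → <-≤-trans lt (m≤n⊔m (suc x) N)) h

fresh : ∀ {xs N v} → All (_< N) xs → N ≤ v → All (v ≢_) xs
fresh h N≤v = All.map (λ { lt refl → <⇒≱ lt N≤v }) h

Cofinal : Pred Vertex 0ℓ → Set
Cofinal S = ∀ N → ∃[ v ] (N ≤ v × S v)

-- Arbitrarily late three-edge paths from x to y: they avoid any given finite part of a path.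
Detours : Rel Vertex 0ℓ → Pred Vertex 0ℓ → Rel Vertex 0ℓ
Detours E S x y = ∀ N → ∃[ a ] ∃[ b ] (N ≤ a × N ≤ b × S a × S b × E x a × E a b × E b y)

module Sweep (E : Rel Vertex 0ℓ) (E-irrefl : ∀ {x} → ¬ E x x) (S : Pred Vertex 0ℓ)
  (S? : ∀ v → Dec (S v)) (S-cofinal : Cofinal S)
  (bridge : ∀ {x y} → S x → S y → x ≢ y → E x y ⊎ Detours E S x y)
  where

  Good : List Vertex → Set
  Good xs = ListPath E xs × All S xs

  append : ∀ {xs x zs} → Good (xs ++ [ x ]) → Linked E (x ∷ zs) → Unique zs →
           All (_∉ (xs ++ [ x ])) zs → All S zs → Good ((xs ++ [ x ]) ++ zs)
  append {xs} (l ⊢ u , s) l′ u′ new s′ =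
    (Linked-glue xs l l′ ⊢ Unique.++⁺ u u′ λ (p , q) → All.lookup new q p) , All.++⁺ s s′

  extend : ∀ xs → Good xs → ∀ {y} → S y → ∃[ zs ] (Good (xs ++ zs) × y ∈ xs ++ zs)
  extend xs g {y} Sy with y ∈? xs
  ... | yes y∈xs = [] , subst (λ ys → Good ys × y ∈ ys) (sym (++-identityʳ xs)) (g , y∈xs)
  ... | no  y∉xs with initLast xs
  ...   | [] = [ y ] , ([-] ⊢ ([] ∷ []) , Sy ∷ []) , here refl
  ...   | ys ∷ʳ′ x with bridge (All.head (All.++⁻ʳ ys (proj₂ g))) Sy (λ { refl → y∉xs (∈-++⁺ʳ ys (here refl)) })
  ...     | inj₁ xy = [ y ] , append g (xy ∷ [-]) ([] ∷ []) (y∉xs ∷ []) (Sy ∷ []) ,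
                      ∈-++⁺ʳ (ys ++ [ x ]) (here refl)
  ...     | inj₂ far
            -- `M` exceeds `y` and every vertex used so far, so a detour beyond `M` meets none of
            -- them; its two inner vertices differ because `E` is irreflexive.
            with M , M-above ← above (y ∷ ys ++ [ x ])
            with a , b , M≤a , M≤b , Sa , Sb , xa , ab , by ← far M
            with a≢y ∷ a-new ← fresh M-above M≤a | b≢y ∷ b-new ← fresh M-above M≤b
            = a ∷ b ∷ [ y ] ,
              append g (xa ∷ ab ∷ by ∷ [-])
                (((λ { refl → E-irrefl ab }) ∷ a≢y ∷ []) ∷ (b≢y ∷ []) ∷ [] ∷ [])
                ((λ p → All.lookup a-new p refl) ∷ (λ p → All.lookup b-new p refl) ∷ y∉xs ∷ [])
                (Sa ∷ Sb ∷ Sy ∷ []) ,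
              ∈-++⁺ʳ (ys ++ [ x ]) (there (there (here refl)))

  step : ∀ n (xs : List Vertex) → Good xs → ∃[ zs ] (Good (xs ++ zs) × (S n → n ∈ xs ++ zs))
  step n xs g with S? n
  ... | yes Sn = map₂ (map₂ λ p _ → p) (extend xs g Sn)
  ... | no ¬Sn = [] , subst Good (sym (++-identityʳ xs)) g , λ Sn → contradiction Sn ¬Sn

  -- Each stage only appends to the one before, so all stages are prefixes of one sequence. Vertex
  -- n, if in `S`, is on the path from stage n + 1 on.
  stage : ℕ → Σ (List Vertex) Good
  stage zero    = [] , ([] ⊢ []) , []
  stage (suc n) = let xs , g = stage n ; zs , g′ , _ = step n xs g in xs ++ zs , g′

  L : ℕ → List Vertex
  L n = proj₁ (stage n)

  L-path : ∀ n → ListPath E (L n)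
  L-path n = proj₁ (proj₂ (stage n))

  L-covers : ∀ {v} → S v → v ∈ L (suc v)
  L-covers {v} = let xs , g = stage v in proj₂ (proj₂ (step v xs g))

  L-grows : ∀ {m n} → m ≤′ n → ∃[ zs ] (L n ≡ L m ++ zs)
  L-grows {m} ≤′-refl     = [] , sym (++-identityʳ (L m))
  L-grows {m} (≤′-step {n} m≤n) =
    let zs , eq = L-grows m≤n ; xs , g = stage n ; ys = proj₁ (step n xs g) in
    zs ++ ys , trans (cong (_++ ys) eq) (++-assoc (L m) zs ys)

  At-grows : ∀ {m n i x} → m ≤ n → At (L m) i x → At (L n) i x
  At-grows m≤n p with zs , eq ← L-grows (≤⇒≤′ m≤n) = subst (λ xs → At xs _ _) (sym eq) (At-++ zs p)

  -- Cofinality forces growth: some `v` in `S` lies above all entries of `L n`, yet it occurs in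
  -- `L (suc v)`, a prolongation of `L n`, which is therefore longer.
  L-long : ∀ i → ∃[ n ] i ≤ length (L n)
  L-long zero    = 0 , z≤n
  L-long (suc i)
    with n , i≤n ← L-long i
    with M , M-above ← above (L n)
    with v , le , Sv ← S-cofinal (n ⊔ M)
    = suc v , longer (L-grows (≤⇒≤′ (m≤n⇒m≤1+n (≤-trans (m≤m⊔n n M) le))))
    where
    v∉ : v ∉ L n
    v∉ p = All.lookup (fresh M-above (≤-trans (m≤n⊔m n M) le)) p refl
    longer : ∃[ zs ] (L (suc v) ≡ L n ++ zs) → suc i ≤ length (L (suc v))
    longer ([]     , eq) = contradiction (subst (v ∈_) (trans eq (++-identityʳ (L n))) (L-covers Sv)) v∉
    longer (z ∷ zs , eq) = ≤-trans (s≤s i≤n) (≤-trans (m≤m+n (suc (length (L n))) (length zs))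
      (≤-reflexive (trans (sym (+-suc (length (L n)) (length zs)))
        (trans (sym (length-++ (L n))) (cong length (sym eq))))))

  entry : ∀ i → ∃[ n ] ∃[ x ] At (L n) i x
  entry i = let n , p = L-long (suc i) in n , At-total (L n) p

  sweep : ℕ → Vertex
  sweep i = proj₁ (proj₂ (entry i))

  At-sweep : ∀ i → ∃[ n ] At (L n) i (sweep i)
  At-sweep i = let n , _ , p = entry i in n , p

  -- Distinctness and adjacency of two entries are read off in one stage that contains both.
  At-sweep₂ : ∀ i j → ∃[ n ] (At (L n) i (sweep i) × At (L n) j (sweep j))
  At-sweep₂ i j = let m , p = At-sweep i ; n , q = At-sweep j in
    m ⊔ n , At-grows (m≤m⊔n m n) p , At-grows (m≤n⊔m m n) q

  sweepPath : InfinitePath E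
  sweepPath = record
    { vertex   = sweep
    ; distinct = λ {i} {j} eq → let n , p , q = At-sweep₂ i j in
        At-injective (unique (L-path n)) p (subst (At (L n) j) (sym eq) q)
    ; directed = inj₁ λ i → let n , p , q = At-sweep₂ i (suc i) in
        At-Linked (linked (L-path n)) p q
    }

  sweep-covers : ∀ v → S v → ∃[ i ] sweep i ≡ v
  sweep-covers v Sv
    with i , p ← ∈⇒At (L-covers Sv)
    with n , q ← At-sweep i
    = i , At-functional (At-grows (m≤n⊔m (suc v) n) q) (At-grows (m≤m⊔n (suc v) n) p)

-- Partitions into cliques

cofinal-or-bounded : ExcludedMiddle 0ℓ → ∀ S → Cofinal S ⊎ ∃[ N ] (∀ v → S v → v < N)
cofinal-or-bounded em S with em {∃[ N ] (∀ v → S v → v < N)}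
... | yes bounded = inj₂ bounded
... | no  unbounded = inj₁ λ N → case N
  where
  case : ∀ N → ∃[ v ] (N ≤ v × S v)
  case N with em {∃[ v ] (N ≤ v × S v)}
  ... | yes h = h
  ... | no ¬h = contradiction (N , λ v s → ≰⇒> λ N≤v → ¬h (v , N≤v , s)) unbounded

NoEdges : ∀ {A : Set} → Rel Vertex 0ℓ → (Vertex → A) → A → A → ℕ → Set
NoEdges E e p p′ N = ∀ m n → N ≤ m → N ≤ n → e m ≡ p → e n ≡ p′ → ¬ E m n

Separated : ∀ {A : Set} → Rel Vertex 0ℓ → (Vertex → A) → ℕ → Set
Separated E e N = ∀ p p′ → p ≢ p′ → NoEdges E e p p′ N ⊎ NoEdges E e p′ p N

NoEdges-mono : ∀ {A : Set} {E} {e : Vertex → A} {p p′ M N} → M ≤ N →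
               NoEdges E e p p′ M → NoEdges E e p p′ N
NoEdges-mono M≤N none m n N≤m N≤n = none m n (≤-trans M≤N N≤m) (≤-trans M≤N N≤n)

Separated-mono : ∀ {A : Set} {E} {e : Vertex → A} {M N} → M ≤ N → Separated E e M → Separated E e N
Separated-mono M≤N sep p p′ p≢p′ with sep p p′ p≢p′
... | inj₁ none = inj₁ (NoEdges-mono M≤N none)
... | inj₂ none = inj₂ (NoEdges-mono M≤N none)

module _ (em : ExcludedMiddle 0ℓ) {E : Rel Vertex 0ℓ} (E-irrefl : ∀ {x} → ¬ E x x) (Q : ℕ)
  (paths-Small : (p : InfinitePath E) → Small em (suc Q) (vertexSet (infinite p)))
  where

  -- A cofinal `S` is covered by a single infinite path, which is small by hypothesis; a bounded `S`
  -- has density 0.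
  bridged-Small : ∀ (S : Pred Vertex 0ℓ) →
    (∀ {x y} → S x → S y → x ≢ y → E x y ⊎ Detours E S x y) →
    Small em (suc Q) S
  bridged-Small S bridge with cofinal-or-bounded em S
  ... | inj₁ cofinal = Small-⊆ em (suc Q) S (vertexSet (infinite sweepPath)) 0
                         (λ v _ → sweep-covers v) (paths-Small sweepPath)
    where open Sweep E E-irrefl S (λ v → em) cofinal bridge
  ... | inj₂ (N , S<N) = Small-bounded em (suc Q) S N S<N

  module CliquePartition (e : Vertex → Fin (suc Q)) (N₀ : ℕ)
    (clique : ∀ {m n} → N₀ ≤ m → N₀ ≤ n → m ≢ n → e m ≡ e n → E m n)
    where

    Class : Fin (suc Q) → Pred Vertex 0ℓ
    Class p v = e v ≡ p

    Class-Small : ∀ p → Small em (suc Q) (Class p)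
    Class-Small p = Small-⊆ em (suc Q) (Class p) (λ v → N₀ ≤ v × Class p v) N₀ (λ v → _,_)
      (bridged-Small _ λ (lx , px) (ly , py) x≢y → inj₁ (clique lx ly x≢y (trans px (sym py))))

    others : ∀ p {v} → e v ≢ p → ⋃ _ (Class ∘ punchIn p) v
    others p e≢p = punchOut (e≢p ∘ sym) , sym (Fin.punchIn-punchOut (e≢p ∘ sym))

    -- If one class were bounded, the `Q` others would cover all late vertices, which small sets
    -- cannot do.
    Class-cofinal : ∀ p → Cofinal (Class p)
    Class-cofinal p with cofinal-or-bounded em (Class p)
    ... | inj₁ cofinal   = cofinal
    ... | inj₂ (N , p<N) = contradiction (λ v N≤v → others p λ e≡p → <⇒≱ (p<N v e≡p) N≤v)
      (few-Small-sets-do-not-cover em Q N (Class ∘ punchIn p) (Class-Small ∘ punchIn p))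

    Class-lower-bound : ∀ p q .{{_ : NonZero q}} → ∃[ N ] (∀ n → N ≤ n →
      suc n * q ≤ (initialCount em (Class p) n * q + suc n) * suc Q)
    Class-lower-bound p = complement-lower-bound em Q (Class p) (Class ∘ punchIn p)
      (Class-Small ∘ punchIn p) split
      where
      split : ∀ v → Class p v ⊎ ⋃ _ (Class ∘ punchIn p) v
      split v with e v Fin.≟ p
      ... | yes e≡p = inj₁ e≡p
      ... | no  e≢p = inj₂ (others p e≢p)

    FarEdges : Fin (suc Q) → Fin (suc Q) → Set
    FarEdges p p′ = ∀ N → ∃[ a ] ∃[ b ] (N ≤ a × N ≤ b × e a ≡ p × e b ≡ p′ × E a b)

    NoEdges-or-FarEdges : ∀ p p′ → (∃[ N ] NoEdges E e p p′ N) ⊎ FarEdges p p′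
    NoEdges-or-FarEdges p p′ with em {∃[ N ] NoEdges E e p p′ N}
    ... | yes none = inj₁ none
    ... | no  some = inj₂ far
      where
      far : FarEdges p p′
      far N with em {∃[ a ] ∃[ b ] (N ≤ a × N ≤ b × e a ≡ p × e b ≡ p′ × E a b)}
      ... | yes h = h
      ... | no ¬h = contradiction
        (N , λ a b la lb pa pb ab → ¬h (a , b , la , lb , pa , pb , ab)) some

    -- A detour from one class to the other goes to the tail of a late cross edge inside the first
    -- clique, crosses, and proceeds to its target inside the second clique.
    pair-Small : ∀ {p p′} → FarEdges p p′ → FarEdges p′ p →
      Small em (suc Q) (λ v → N₀ ≤ v × (e v ≡ p ⊎ e v ≡ p′))
    pair-Small {p} {p′} far far′ = bridged-Small S bridge
      where
      S : Pred Vertex 0ℓ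
      S v = N₀ ≤ v × (e v ≡ p ⊎ e v ≡ p′)
      cross : ∀ {s t} → FarEdges s t → (∀ {v} → N₀ ≤ v → e v ≡ s ⊎ e v ≡ t → S v) →
        ∀ {x y} → N₀ ≤ x → N₀ ≤ y → e x ≡ s → e y ≡ t → Detours E S x y
      cross far inS {x} {y} lx ly ex ey N
        -- Beyond `N₀` the clique edges are available; `suc x` and `suc y` keep `a` apart from `x`
        -- and `b` apart from `y`.
        with a , b , la , lb , ea , eb , ab ← far (N ⊔ N₀ ⊔ suc x ⊔ suc y)
        = a , b , a≥N , b≥N , inS a≥N₀ (inj₁ ea) , inS b≥N₀ (inj₂ eb) ,
          clique lx a≥N₀ (<⇒≢ a>x) (trans ex (sym ea)) , ab ,
          clique b≥N₀ ly (<⇒≢ b>y ∘ sym) (trans eb (sym ey))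
        where
        a≥N = ≤-trans (≤-trans (≤-trans (m≤m⊔n N N₀) (m≤m⊔n _ (suc x))) (m≤m⊔n _ (suc y))) la
        b≥N = ≤-trans (≤-trans (≤-trans (m≤m⊔n N N₀) (m≤m⊔n _ (suc x))) (m≤m⊔n _ (suc y))) lb
        a≥N₀ = ≤-trans (≤-trans (≤-trans (m≤n⊔m N N₀) (m≤m⊔n _ (suc x))) (m≤m⊔n _ (suc y))) la
        b≥N₀ = ≤-trans (≤-trans (≤-trans (m≤n⊔m N N₀) (m≤m⊔n _ (suc x))) (m≤m⊔n _ (suc y))) lb
        a>x = ≤-trans (≤-trans (m≤n⊔m (N ⊔ N₀) (suc x)) (m≤m⊔n _ (suc y))) la
        b>y = ≤-trans (m≤n⊔m (N ⊔ N₀ ⊔ suc x) (suc y)) lb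
      bridge : ∀ {x y} → S x → S y → x ≢ y → E x y ⊎ Detours E S x y
      bridge (lx , inj₁ px) (ly , inj₁ py) x≢y = inj₁ (clique lx ly x≢y (trans px (sym py)))
      bridge (lx , inj₂ px) (ly , inj₂ py) x≢y = inj₁ (clique lx ly x≢y (trans px (sym py)))
      bridge (lx , inj₁ px) (ly , inj₂ py) _   = inj₂ (cross far _,_ lx ly px py)
      bridge (lx , inj₂ px) (ly , inj₁ py) _   =
        inj₂ (cross far′ (λ { l (inj₁ q) → l , inj₂ q ; l (inj₂ q) → l , inj₁ q }) lx ly px py)

    -- Merging p′ into p would leave only Q small sets covering all vertices.
    ¬FarEdges-both-ways : ∀ {p p′} → p ≢ p′ → FarEdges p p′ → ¬ FarEdges p′ p
    ¬FarEdges-both-ways {p} {p′} p≢p′ far far′ =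
      few-Small-sets-do-not-cover em Q 0 Merged Merged-Small λ v _ → cover v
      where
      Merged : Fin Q → Pred Vertex 0ℓ
      Merged q v = Class (punchIn p′ q) v ⊎ (punchIn p′ q ≡ p × Class p′ v)
      Merged-Small : ∀ q → Small em (suc Q) (Merged q)
      Merged-Small q with punchIn p′ q Fin.≟ p
      ... | yes q≡p = Small-⊆ em (suc Q) _ _ N₀
        (λ { v l (inj₁ h) → l , inj₁ (trans h q≡p) ; v l (inj₂ (_ , h)) → l , inj₂ h })
        (pair-Small far far′)
      ... | no  q≢p = Small-⊆ em (suc Q) _ _ 0
        (λ { v l (inj₁ h) → h ; v l (inj₂ (h , _)) → contradiction h q≢p })
        (Class-Small (punchIn p′ q))
      cover : ∀ v → ⋃ _ Merged v
      cover v with e v Fin.≟ p′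
      ... | yes e≡p′ = punchOut (p≢p′ ∘ sym) , inj₂ (Fin.punchIn-punchOut (p≢p′ ∘ sym) , e≡p′)
      ... | no  e≢p′ = map₂ inj₁ (others p′ e≢p′)

    -- Of the two directions between distinct classes at most one has arbitrarily late edges; there
    -- are finitely many pairs of classes, so one threshold serves all.
    separated : ∃[ N ] Separated E e N
    separated = let N , h = eventually-all _ λ p → eventually-all _ (eventually p) in
      N , h N ≤-refl
      where
      eventually : ∀ p p′ → ∃[ M ] (∀ N → M ≤ N → p ≢ p′ → NoEdges E e p p′ N ⊎ NoEdges E e p′ p N)
      eventually p p′ with p Fin.≟ p′
      ... | yes p≡p′ = 0 , λ _ _ p≢p′ → contradiction p≡p′ p≢p′
      ... | no  p≢p′ with NoEdges-or-FarEdges p p′ | NoEdges-or-FarEdges p′ p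
      ...   | inj₁ (M , none) | _               = M , λ N M≤N _ → inj₁ (NoEdges-mono M≤N none)
      ...   | _               | inj₁ (M , none) = M , λ N M≤N _ → inj₂ (NoEdges-mono M≤N none)
      ...   | inj₂ far        | inj₂ far′       = contradiction far′ (¬FarEdges-both-ways p≢p′ far)

-- The Gallai–Roy theorem

greatest : ExcludedMiddle 0ℓ → ∀ (T : ℕ → Set) b → T 0 → (∀ j → T j → j < b) →
           ∃[ k ] (T k × ∀ j → T j → j ≤ k)
greatest em T zero    t T<b = contradiction (T<b 0 t) λ ()
greatest em T (suc b) t T<b with em {T b}
... | yes Tb = b , Tb , λ j Tj → ≤-pred (T<b j Tj)
... | no ¬Tb = greatest em T b t λ j Tj → ≤∧≢⇒< (≤-pred (T<b j Tj)) λ { refl → ¬Tb Tj }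

module GallaiRoy (em : ExcludedMiddle 0ℓ) (E : Rel Vertex 0ℓ) where

  -- D n is a maximal acyclic subdigraph of E on the vertices below n: the new vertex n gets all
  -- its out-edges, and then those in-edges that close no cycle.
  mutual
    D : ℕ → Rel Vertex 0ℓ
    D zero    x y = ⊥
    D (suc n) x y = D n x y ⊎ (x ≡ n × y < n × E x y) ⊎ (y ≡ n × x < n × E x y × ¬ Reach n x)

    Reach : ℕ → Pred Vertex 0ℓ
    Reach n x = ∃[ w ] (w < n × E n w × Star (D n) w x)

  D-bounded : ∀ n {x y} → D n x y → x < n × y < n
  D-bounded (suc n) (inj₁ d)                            = let p , q = D-bounded n d in m≤n⇒m≤1+n p , m≤n⇒m≤1+n q
  D-bounded (suc n) (inj₂ (inj₁ (refl , y<n , _)))      = ≤-refl , m≤n⇒m≤1+n y<n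
  D-bounded (suc n) (inj₂ (inj₂ (refl , x<n , _ , _)))  = m≤n⇒m≤1+n x<n , ≤-refl

  D⇒E : ∀ n {x y} → D n x y → E x y
  D⇒E (suc n) (inj₁ d)                           = D⇒E n d
  D⇒E (suc n) (inj₂ (inj₁ (_ , _ , xy)))         = xy
  D⇒E (suc n) (inj₂ (inj₂ (_ , _ , xy , _)))     = xy

  D-mono : ∀ {m n} → m ≤′ n → ∀ {x y} → D m x y → D n x y
  D-mono ≤′-refl       d = d
  D-mono (≤′-step m≤n) d = inj₁ (D-mono m≤n d)

  Star-bounded : ∀ n {x y} → x < n → Star (D n) x y → y < n
  Star-bounded n x<n ε       = x<n
  Star-bounded n x<n (d ◅ s) = Star-bounded n (proj₂ (D-bounded n d)) s

  Reach-bounded : ∀ n {x} → Reach n x → x < n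
  Reach-bounded n (w , w<n , _ , s) = Star-bounded n w<n s

  Reach-start : ∀ n {y} → D (suc n) n y → Reach n y
  Reach-start n (inj₁ d)                              = contradiction (proj₁ (D-bounded n d)) (<-irrefl refl)
  Reach-start n (inj₂ (inj₁ (_ , y<n , xy)))          = _ , y<n , xy , ε
  Reach-start n (inj₂ (inj₂ (_ , n<n , _ , _)))       = contradiction n<n (<-irrefl refl)

  -- The set of vertices reached from `n` is closed under `D (suc n)`: the new in-edges of `n` start
  -- only at vertices that `n` does not reach.
  Reach-step : ∀ n {x y} → Reach n x → D (suc n) x y → Reach n y
  Reach-step n (w , w<n , nw , s) (inj₁ d)            = w , w<n , nw , s ◅◅ d ◅ ε
  Reach-step n r (inj₂ (inj₁ (refl , _)))             = contradiction (Reach-bounded n r) (<-irrefl refl)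
  Reach-step n r (inj₂ (inj₂ (_ , _ , _ , ¬r)))       = contradiction r ¬r

  Reach-Star : ∀ n {x y} → Reach n x → Star (D (suc n)) x y → Reach n y
  Reach-Star n r ε       = r
  Reach-Star n r (d ◅ s) = Reach-Star n (Reach-step n r d) s

  -- The first edge of a closed walk at `n` enters the reach of `n`, and by closure the walk stays
  -- there; but this set lies below `n`.
  no-return : ∀ n {x y} → Star (D (suc n)) n x → D (suc n) x y → ¬ Star (D (suc n)) y n
  no-return n ε       d s′ = <-irrefl refl (Reach-bounded n (Reach-Star n (Reach-start n d) s′))
  no-return n (d ◅ s) e s′ = <-irrefl refl (Reach-bounded n (Reach-Star n (Reach-start n d) (s ◅◅ e ◅ s′)))

  -- Every edge added at this stage is incident to `n`.
  via-new : ∀ n {x y} → Star (D (suc n)) x y →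
            Star (D n) x y ⊎ (Star (D (suc n)) x n × Star (D (suc n)) n y)
  via-new n ε = inj₁ ε
  via-new n (d ◅ s) with via-new n s
  via-new n (d ◅ s)                    | inj₂ (s₁ , s₂) = inj₂ (d ◅ s₁ , s₂)
  via-new n (inj₁ d ◅ s)               | inj₁ s′ = inj₁ (d ◅ s′)
  via-new n (inj₂ (inj₁ (refl , e)) ◅ s) | inj₁ s′ = inj₂ (ε , inj₂ (inj₁ (refl , e)) ◅ s)
  via-new n (inj₂ (inj₂ (refl , e)) ◅ s) | inj₁ s′ = inj₂ (inj₂ (inj₂ (refl , e)) ◅ ε , s)

  D-acyclic : ∀ n {x y} → D n x y → ¬ Star (D n) y x
  D-acyclic (suc n) e@(inj₂ (inj₁ (refl , _))) s = no-return n ε e s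
  D-acyclic (suc n) e@(inj₂ (inj₂ (refl , _))) s = no-return n s e ε
  D-acyclic (suc n) e@(inj₁ d) s with via-new n s
  ... | inj₁ s′        = D-acyclic n d s′
  ... | inj₂ (s₁ , s₂) = no-return n s₂ e s₁

  D∞ : Rel Vertex 0ℓ
  D∞ x y = ∃[ n ] D n x y

  Star-D∞ : ∀ {x y} → Star D∞ x y → ∃[ n ] Star (D n) x y
  Star-D∞ ε             = 0 , ε
  Star-D∞ ((m , d) ◅ s) = let n , s′ = Star-D∞ s in
    m ⊔ n , D-mono (≤⇒≤′ (m≤m⊔n m n)) d ◅ Star.map (D-mono (≤⇒≤′ (m≤n⊔m m n))) s′

  D∞-acyclic : ∀ {x y} → D∞ x y → ¬ Star D∞ y x
  D∞-acyclic (m , d) s = let n , s′ = Star-D∞ s in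
    D-acyclic (m ⊔ n) (D-mono (≤⇒≤′ (m≤m⊔n m n)) d) (Star.map (D-mono (≤⇒≤′ (m≤n⊔m m n))) s′)

  _⇝_ : Rel Vertex 0ℓ
  x ⇝ y = ∃[ z ] (D∞ x z × Star D∞ z y)

  -- This is the maximality of the construction: an edge is decided when its larger end is added,
  -- and it is left out only if a walk back exists already.
  D∞-comparable : ∀ {x y} → x ≢ y → E x y → x ⇝ y ⊎ y ⇝ x
  D∞-comparable {x} {y} x≢y xy with <-cmp x y
  ... | tri≈ _ x≡y _ = contradiction x≡y x≢y
  ... | tri> _ _ y<x = inj₁ (y , (suc x , inj₂ (inj₁ (refl , y<x , xy))) , ε)
  ... | tri< x<y _ _ with em {Reach y x}
  ...   | yes (w , w<y , yw , s) =
          inj₂ (w , (suc y , inj₂ (inj₁ (refl , w<y , yw))) , Star.map (y ,_) s)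
  ...   | no ¬r = inj₁ (y , (suc y , inj₂ (inj₂ (refl , x<y , xy , ¬r))) , ε)

  D∞-walk : ∀ {x y xs} → Linked D∞ (x ∷ xs) → y ∈ xs → x ⇝ y
  D∞-walk (d ∷ _) (here refl) = _ , d , ε
  D∞-walk (d ∷ l) (there p)   = let z , d′ , s = D∞-walk l p in _ , d , d′ ◅ s

  -- In an acyclic digraph every walk is a path, so the bound on paths also bounds walks, and
  -- heights are well defined.
  D∞-ListPath : ∀ {xs} → Linked D∞ xs → ListPath E xs
  D∞-ListPath l = Linked.map (λ (n , d) → D⇒E n d) l ⊢ acyclic-unique l
    where
    acyclic-unique : ∀ {xs} → Linked D∞ xs → Unique xs
    acyclic-unique {[]}     _ = []
    acyclic-unique {x ∷ xs} l = All.tabulate (λ { p refl → let z , d , s = D∞-walk l p in D∞-acyclic d s })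
                        ∷ acyclic-unique (Linked.tail l)

  module _ {ℓ} (none : ¬ FinitePath E ℓ) where

    Walk : Vertex → ℕ → Set
    Walk v k = ∃[ xs ] (Linked D∞ (v ∷ xs) × length xs ≡ k)

    Walk-bounded : ∀ {v} k → Walk v k → k < ℓ
    Walk-bounded k (xs , l , refl) = ListPath-length none (D∞-ListPath l)

    longest : ∀ v → ∃[ k ] (Walk v k × ∀ j → Walk v j → j ≤ k)
    longest v = greatest em (Walk v) ℓ ([] , [-] , refl) Walk-bounded

    height : Vertex → ℕ
    height v = proj₁ (longest v)

    height-D∞ : ∀ {x y} → D∞ x y → height y < height x
    height-D∞ {x} {y} d with _ , (xs , l , eq) , _ ← longest y =
      proj₂ (proj₂ (longest x)) _ (y ∷ xs , d ∷ l , cong suc eq)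

    height-Star : ∀ {x y} → Star D∞ x y → height y ≤ height x
    height-Star ε       = ≤-refl
    height-Star (d ◅ s) = ≤-trans (height-Star s) (<⇒≤ (height-D∞ d))

    height-⇝ : ∀ {x y} → x ⇝ y → height y < height x
    height-⇝ (z , d , s) = ≤-<-trans (height-Star s) (height-D∞ d)

    colour : Vertex → Fin ℓ
    colour v = fromℕ< (Walk-bounded (height v) (proj₁ (proj₂ (longest v))))

    -- Height drops along every nonempty walk of `D∞`, and the ends of an `E`-edge are joined by
    -- such a walk in one direction or the other.
    colour-proper : ∀ {x y} → x ≢ y → E x y → colour x ≢ colour y
    colour-proper {x} {y} x≢y xy eq
      with hx≡hy ← trans (sym (Fin.toℕ-fromℕ< _)) (trans (cong Fin.toℕ eq) (Fin.toℕ-fromℕ< _))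
      with D∞-comparable x≢y xy
    ... | inj₁ p = <-irrefl (sym hx≡hy) (height-⇝ p)
    ... | inj₂ p = <-irrefl hx≡hy (height-⇝ p)

-- Rédei's theorem and paths along a line

module _ {A : Set} {R : Rel A 0ℓ} where

  -- `x` is placed before the first `z` recorded with an edge from `x`, or else at the end. `y`
  -- remains in front, so the result can be attached to what precedes it.
  insert-after : ∀ x y ys → R y x → All (λ z → R x z ⊎ R z x) ys → Linked R (y ∷ ys) →
                 ∃[ zs ] (Linked R (y ∷ zs) × zs ↭ x ∷ ys)
  insert-after x y []       yx _            _        = [ x ] , yx ∷ [-] , ↭-refl
  insert-after x y (z ∷ ys) yx (inj₁ xz ∷ t) (_ ∷ l)  = x ∷ z ∷ ys , yx ∷ xz ∷ l , ↭-refl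
  insert-after x y (z ∷ ys) yx (inj₂ zx ∷ t) (yz ∷ l) =
    let zs , l′ , p = insert-after x z ys zx t l in
    z ∷ zs , yz ∷ l′ , ↭-trans (prep z p) (swap z x ↭-refl)

  insert : ∀ x ys → All (λ z → R x z ⊎ R z x) ys → Linked R ys →
           ∃[ zs ] (Linked R zs × zs ↭ x ∷ ys)
  insert x []       _             _ = [ x ] , [-] , ↭-refl
  insert x (y ∷ ys) (inj₁ xy ∷ _) l = x ∷ y ∷ ys , xy ∷ l , ↭-refl
  insert x (y ∷ ys) (inj₂ yx ∷ t) l =
    let zs , l′ , p = insert-after x y ys yx t l in
    y ∷ zs , l′ , ↭-trans (prep y p) (swap y x ↭-refl)

  redei : ∀ xs → AllPairs (λ x y → R x y ⊎ R y x) xs → ∃[ zs ] (Linked R zs × zs ↭ xs)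
  redei []       _       = [] , [] , ↭-refl
  redei (x ∷ xs) (t ∷ ts) =
    let ys , l  , p = redei xs ts
        zs , l′ , q = insert x ys (All-resp-↭ (↭-sym p) t) l
    in zs , l′ , ↭-trans q (prep x p)

  -- A zipper: `ps` holds the entries already passed, the most recent one first.
  split-at : ∀ {x y} ps xs → Linked (flip R) (x ∷ ps) → Linked R (x ∷ xs) → y ∈ x ∷ xs →
    ∃[ qs ] ∃[ ys ] (Linked (flip R) (y ∷ qs) × Linked R (y ∷ ys) ×
                     length qs + length ys ≡ length ps + length xs)
  split-at ps xs       lp l       (here refl) = ps , xs , lp , l , refl
  split-at ps (z ∷ xs) lp (r ∷ l) (there y∈)  =
    let qs , ys , lq , ly , eq = split-at (_ ∷ ps) xs (r ∷ lp) l y∈ in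
    qs , ys , lq , ly , trans eq (sym (+-suc (length ps) (length xs)))

-- What is kept of a Hamiltonian path through `i`: the part before `i`, listed backwards and hence
-- linked by `flip R`, and the part after it.
record Rank {n} (R : Rel (Fin n) 0ℓ) (i : Fin n) : Set where
  field
    before  : List (Fin n)
    after   : List (Fin n)
    linked⁻ : Linked (flip R) (i ∷ before)
    linked⁺ : Linked R (i ∷ after)
    total   : suc (length before + length after) ≡ n

  after<n : length after < n
  after<n = ≤-trans (s≤s (m≤n+m (length after) (length before))) (≤-reflexive total)

rank : ∀ {n} (R : Rel (Fin n) 0ℓ) → (∀ {i j} → i ≢ j → R i j ⊎ R j i) → ∀ i → Rank R i
rank {n} R tot i
  with redei (allFin n) (AllPairs.map tot (Unique.allFin⁺ n))
... | [] , _ , p = contradiction (∈-resp-↭ (↭-sym p) (∈-allFin i)) λ ()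
... | z ∷ zs , l , p
  with qs , ys , lq , ly , eq ← split-at [] zs [-] l (∈-resp-↭ (↭-sym p) (∈-allFin i))
  = record
  { before  = qs ; after = ys ; linked⁻ = lq ; linked⁺ = ly
  ; total   = trans (cong suc eq) (trans (↭-length p) (length-tabulate id))
  }

module _ {A : Set} (C : A → Pred Vertex 0ℓ) (cofinal : ∀ i → Cofinal (C i))
         (N : ℕ) (E : Rel Vertex 0ℓ) (R : Rel A 0ℓ)
         (edges : ∀ {i j u v} → R i j → N ≤ u → N ≤ v → C i u → C j v → E u v) where

  -- One vertex per class is chosen in increasing order, which makes them distinct; starting beyond
  -- `M` keeps them off a path built earlier.
  continue : ∀ {i v} js → Linked R (i ∷ js) → N ≤ v → C i v → ∀ M →
    ∃[ vs ] (Linked E (v ∷ vs) × All (M ≤_) vs × Unique vs × length vs ≡ length js)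
  continue []       _       _   _  M = [] , [-] , [] , [] , refl
  continue (j ∷ js) (r ∷ l) N≤v Cv M
    with w , le , Cw ← cofinal j (M ⊔ N)
    with ws , lw , ws>w , uw , eq ← continue js l (≤-trans (m≤n⊔m M N) le) Cw (suc w)
    = w ∷ ws , edges r N≤v (≤-trans (m≤n⊔m M N) le) Cv Cw ∷ lw ,
      M≤w ∷ All.map (λ lt → ≤-trans M≤w (<⇒≤ lt)) ws>w ,
      All.map <⇒≢ ws>w ∷ uw , cong suc eq
    where
    M≤w : M ≤ w
    M≤w = ≤-trans (m≤m⊔n M N) le

  -- The path grows at its front, one class at a time, each new vertex being chosen above all those
  -- already on it.
  precede : ∀ {i u us} js → Linked (flip R) (i ∷ js) → N ≤ u → C i u → ListPath E (u ∷ us) →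
    ∃[ vs ] (ListPath E vs × length vs ≡ length js + suc (length us))
  precede []       _       _   _  p = _ , p , refl
  precede {us = us} (j ∷ js) (r ∷ l) N≤u Cu p@(lu ⊢ uu)
    with M , M-above ← above (_ ∷ us)
    with w , le , Cw ← cofinal j (M ⊔ N)
    with vs , q , eq ← precede js l (≤-trans (m≤n⊔m M N) le) Cw
           ((edges r (≤-trans (m≤n⊔m M N) le) N≤u Cw Cu ∷ lu)
            ⊢ (fresh M-above (≤-trans (m≤m⊔n M N) le) ∷ uu))
    = vs , q , trans eq (+-suc (length js) (suc (length us)))

-- Numbering the classes, and values of the cube colouring

encode : ∀ {r} (ℓ : Fin r → ℕ) → Index ℓ → Fin (Π ℓ)
encode {zero}  ℓ t = zero
encode {suc r} ℓ t = combine (t zero) (encode (ℓ ∘ suc) (t ∘ suc))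

-- Indices are functions compared pointwise; their codes turn this into equality in a finite type,
-- in which classes can be counted.
encode-cong : ∀ {r} (ℓ : Fin r → ℕ) {s t : Index ℓ} → (∀ k → s k ≡ t k) → encode ℓ s ≡ encode ℓ t
encode-cong {zero}  ℓ eq = refl
encode-cong {suc r} ℓ eq = cong₂ combine (eq zero) (encode-cong (ℓ ∘ suc) (eq ∘ suc))

encode-injective : ∀ {r} (ℓ : Fin r → ℕ) {s t : Index ℓ} → encode ℓ s ≡ encode ℓ t → ∀ k → s k ≡ t k
encode-injective ℓ {s} {t} eq zero    = proj₁ (Fin.combine-injective (s zero) _ (t zero) _ eq)
encode-injective ℓ {s} {t} eq (suc k) =
  encode-injective (ℓ ∘ suc) (proj₂ (Fin.combine-injective (s zero) _ (t zero) _ eq)) k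

module _ {r} {ℓ : Fin r → ℕ} where

  update : Index ℓ → (k : Fin r) → Fin (ℓ k) → Index ℓ
  update s k i k′ with k Fin.≟ k′
  ... | yes refl = i
  ... | no  _    = s k′

  update-same : ∀ s k i → update s k i k ≡ i
  update-same s k i with k Fin.≟ k
  ... | yes refl = refl
  ... | no  k≢k  = contradiction refl k≢k

  update-other : ∀ s k i {k′} → k ≢ k′ → update s k i k′ ≡ s k′
  update-other s k i {k′} k≢k′ with k Fin.≟ k′
  ... | yes k≡k′ = contradiction k≡k′ k≢k′
  ... | no  _    = refl

  update-self : ∀ s k k′ → update s k (s k) k′ ≡ s k′
  update-self s k k′ with k Fin.≟ k′
  ... | yes refl = refl
  ... | no  _    = refl

  module _ (U : CubePartition ℓ) {m n : Vertex} .(m≢n : m ≢ n) where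

    cubeColouring-ascending : (∀ k → U m k Fin.≤ U n k) → cubeColouring U m n m≢n ≡ lastColour r
    cubeColouring-ascending asc with Fin.all? (λ k → U m k Fin.≟ U n k)
    ... | yes _ = refl
    ... | no differ
      with k , k≢ , _ ← Fin.¬∀⟶∃¬-smallest r _ (λ k → U m k Fin.≟ U n k) differ
      with U m k Fin.<? U n k
    ... | yes _ = refl
    ... | no  ≮ = contradiction (≤∧≢⇒< (asc k) (k≢ ∘ Fin.toℕ-injective)) ≮

    -- `k` is the only coordinate in which the two classes differ, hence also the first.
    cubeColouring-descending : ∀ k → U m k Fin.> U n k → (∀ k′ → k′ ≢ k → U m k′ ≡ U n k′) →
                               cubeColouring U m n m≢n ≡ boundedColour k
    cubeColouring-descending k desc agree with Fin.all? (λ k → U m k Fin.≟ U n k)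
    ... | yes same = contradiction (subst (Fin._< U m k) (sym (same k)) desc) (<-irrefl refl)
    ... | no differ
      with k₁ , k₁≢ , _ ← Fin.¬∀⟶∃¬-smallest r _ (λ k → U m k Fin.≟ U n k) differ
      with k₁ Fin.≟ k
    ... | no  k₁≢k = contradiction (agree k₁ k₁≢k) k₁≢
    ... | yes refl with U m k Fin.<? U n k
    ...   | yes asc = contradiction asc (<-asym desc)
    ...   | no  _   = refl

-- Proper partitions and their cliques

module Structure (em : ExcludedMiddle 0ℓ) {r} {ℓ : Fin r → ℕ} (c : EdgeColouring (Colour r))
  (short : ∀ i → ¬ FinitePath (EdgeOfColour c (boundedColour i)) (ℓ i))
  (Q : ℕ) (enc : Index ℓ → Fin (suc Q))
  (enc-cong : ∀ {s t} → (∀ k → s k ≡ t k) → enc s ≡ enc t)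
  (enc-injective : ∀ {s t} → enc s ≡ enc t → ∀ k → s k ≡ t k)
  (paths-Small : (p : InfinitePath (EdgeOfColour c (lastColour r))) →
                 Small em (suc Q) (vertexSet (infinite p)))
  where

  Bounded : Fin r → Rel Vertex 0ℓ
  Bounded k = EdgeOfColour c (boundedColour k)

  Last : Rel Vertex 0ℓ
  Last = EdgeOfColour c (lastColour r)

  Last-or-Bounded : ∀ {m n} → m ≢ n → Last m n ⊎ ∃[ k ] Bounded k m n
  Last-or-Bounded {m} {n} m≢n = from (Top.view (c m n m≢n)) refl
    where
    from : ∀ {i} → Top.View i → c m n m≢n ≡ i → Last m n ⊎ ∃[ k ] Bounded k m n
    from Top.‵fromℕ       eq = inj₁ (m≢n , eq)
    from (Top.‵inject₁ k) eq = inj₂ (k , m≢n , eq)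

  module _ (V : CubePartition ℓ) (N : ℕ)
    (V-proper : ∀ {k m n} → N ≤ m → N ≤ n → Bounded k m n → V m k ≢ V n k) where

    -- An edge of bounded colour changes the coordinate of that colour, so it cannot stay inside a
    -- class.
    clique : ∀ {m n} → N ≤ m → N ≤ n → m ≢ n → enc (V m) ≡ enc (V n) → Last m n
    clique N≤m N≤n m≢n eq with Last-or-Bounded m≢n
    ... | inj₁ last     = last
    ... | inj₂ (k , mn) = contradiction (enc-injective eq k) (V-proper N≤m N≤n mn)

    module Classes = CliquePartition em {Last} (λ e → proj₁ e refl) Q paths-Small (enc ∘ V) N clique

  -- Ranking the classes along lines

  module Ranked (W : CubePartition ℓ) (N : ℕ)
    (W-proper : ∀ {k m n} → Bounded k m n → W m k ≢ W n k)
    (W-cofinal : ∀ p → Cofinal (λ v → enc (W v) ≡ p))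
    (W-separated : Separated Last (enc ∘ W) N)
    where

    module _ (s : Index ℓ) (k : Fin r) where

      Line : Fin (ℓ k) → Pred Vertex 0ℓ
      Line i v = enc (W v) ≡ enc (update s k i)

      _⇒_ : Rel (Fin (ℓ k)) 0ℓ
      i ⇒ j = ∀ u v → N ≤ u → N ≤ v → Line i u → Line j v → Bounded k u v

      distinct : ∀ {i j} → i ≢ j → enc (update s k i) ≢ enc (update s k j)
      distinct {i} {j} i≢j eq =
        i≢j (trans (sym (update-same s k i)) (trans (enc-injective eq k) (update-same s k j)))

      -- With the last colour excluded, the colour is some bounded `k′`, and its edges change
      -- coordinate `k′`; two classes on the line differ only in coordinate `k`.
      NoEdges⇒⇒ : ∀ {i j} → i ≢ j →
        NoEdges Last (enc ∘ W) (enc (update s k i)) (enc (update s k j)) N → i ⇒ j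
      NoEdges⇒⇒ {i} {j} i≢j none u v N≤u N≤v u∈i v∈j
        with Last-or-Bounded {u} {v} (λ { refl → distinct i≢j (trans (sym u∈i) v∈j) })
      ... | inj₁ last = contradiction last (none u v N≤u N≤v u∈i v∈j)
      ... | inj₂ (k′ , uv) with k Fin.≟ k′
      ...   | yes refl = uv
      ...   | no  k≢k′ = contradiction
        (trans (trans (enc-injective u∈i k′) (update-other s k i k≢k′))
               (sym (trans (enc-injective v∈j k′) (update-other s k j k≢k′))))
        (W-proper uv)

      ⇒-total : ∀ {i j} → i ≢ j → i ⇒ j ⊎ j ⇒ i
      ⇒-total i≢j with W-separated _ _ (distinct i≢j)
      ... | inj₁ none = inj₁ (NoEdges⇒⇒ i≢j none)
      ... | inj₂ none = inj₂ (NoEdges⇒⇒ (i≢j ∘ sym) none)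

      Line-cofinal : ∀ i → Cofinal (Line i)
      Line-cofinal i = W-cofinal (enc (update s k i))

      line-rank : Rank _⇒_ (s k)
      line-rank = rank _⇒_ ⇒-total (s k)

    Line-self : ∀ v k → Line (W v) k (W v k) v
    Line-self v k = enc-cong λ k′ → sym (update-self (W v) k k′)

    -- One vertex from each class before that of `u`, then `u` and `v`, then one vertex from each
    -- class after that of `v` form a path of colour `k`, which has at most `ℓ k` vertices. As the
    -- line of `u` has exactly `ℓ k` classes, fewer follow `v` than follow `u`. The ranks are
    -- arbitrary, so the orders on the two lines may be unrelated.
    rank-descends : ∀ {k u v} → N ≤ u → N ≤ v → Bounded k u v →
      ∀ (ρu : Rank (_⇒_ (W u) k) (W u k)) (ρv : Rank (_⇒_ (W v) k) (W v k)) →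
      length (Rank.after ρv) < length (Rank.after ρu)
    rank-descends {k} {u} {v} N≤u N≤v uv ρu ρv
      -- Starting above both `u` and `v` keeps the continuation off the edge that it prolongs.
      with vs , lvs , vs≥M , uvs , |vs| ← continue (Line (W v) k) (Line-cofinal (W v) k) N (Bounded k)
             (_⇒_ (W v) k) (λ r lu lv → r _ _ lu lv) (Rank.after ρv) (Rank.linked⁺ ρv)
             N≤v (Line-self v k) (suc u ⊔ suc v)
      with ps , path , |ps| ← precede (Line (W u) k) (Line-cofinal (W u) k) N (Bounded k)
             (_⇒_ (W u) k) (λ r lu lv → r _ _ lu lv) (Rank.before ρu) (Rank.linked⁻ ρu)
             N≤u (Line-self u k)
             ((uv ∷ lvs)
              ⊢ ((proj₁ uv ∷ All.map (λ le → <⇒≢ (≤-trans (m≤m⊔n (suc u) (suc v)) le)) vs≥M)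
                 ∷ All.map (λ le → <⇒≢ (≤-trans (m≤n⊔m (suc u) (suc v)) le)) vs≥M ∷ uvs))
      -- The path has b + 2 + a′ vertices and the line of `u` has b + 1 + a classes, where b and a
      -- count those before and after `u`, and a′ those after `v`.
      = +-cancelˡ-≤ (suc (length (before ρu))) _ _ (begin
        suc (length (before ρu)) + suc (length (after ρv))
          ≡⟨ cong (λ l → suc (length (before ρu)) + suc l) |vs| ⟨
        suc (length (before ρu)) + suc (length vs)
          ≡⟨ +-suc (length (before ρu)) (suc (length vs)) ⟨
        length (before ρu) + suc (suc (length vs))
          ≡⟨ |ps| ⟨
        length ps
          ≤⟨ ListPath-length (short k) path ⟩
        ℓ k
          ≡⟨ total ρu ⟨
        suc (length (before ρu)) + length (after ρu) ∎)
      where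
      open ≤-Reasoning
      open Rank

    U : CubePartition ℓ
    U v k = fromℕ< (Rank.after<n (line-rank (W v) k))

    U-descends : ∀ {k u v} → N ≤ u → N ≤ v → Bounded k u v → U v k Fin.< U u k
    U-descends {k} {u} {v} N≤u N≤v uv =
      subst₂ _<_ (sym (Fin.toℕ-fromℕ< _)) (sym (Fin.toℕ-fromℕ< _))
        (rank-descends N≤u N≤v uv (line-rank (W u) k) (line-rank (W v) k))

  descending-partition : ∃[ N ] Σ[ U ∈ CubePartition ℓ ]
    (∀ {k u v} → N ≤ u → N ≤ v → Bounded k u v → U v k Fin.< U u k)
  descending-partition = N , U , U-descends
    where
    W : CubePartition ℓ
    W v k = GallaiRoy.colour em (Bounded k) (short k) v
    W-proper : ∀ {k m n} → Bounded k m n → W m k ≢ W n k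
    W-proper {k} e@(m≢n , _) = GallaiRoy.colour-proper em (Bounded k) (short k) m≢n e
    N : ℕ
    -- `W` is proper on all vertices, hence the threshold 0; beyond `N` its classes are separated.
    N = proj₁ (Classes.separated W 0 λ _ _ → W-proper)
    open Ranked W N W-proper (Classes.Class-cofinal W 0 λ _ _ → W-proper)
      (proj₂ (Classes.separated W 0 λ _ _ → W-proper))

  -- Colours of the slide edges

  module Slide (U : CubePartition ℓ) (N : ℕ)
    (U-descends : ∀ {k u v} → N ≤ u → N ≤ v → Bounded k u v → U v k Fin.< U u k)
    where

    U-proper : ∀ {k m n} → N ≤ m → N ≤ n → Bounded k m n → U m k ≢ U n k
    U-proper N≤m N≤n mn eq = <-irrefl (cong Fin.toℕ (sym eq)) (U-descends N≤m N≤n mn)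

    ascending⇒Last : ∀ {m n} → N ≤ m → N ≤ n → m ≢ n → (∀ k → U m k Fin.≤ U n k) → Last m n
    ascending⇒Last N≤m N≤n m≢n asc with Last-or-Bounded m≢n
    ... | inj₁ last     = last
    ... | inj₂ (k , mn) = contradiction (U-descends N≤m N≤n mn) (≤⇒≯ (asc k))

    module _ (U-cofinal : ∀ p → Cofinal (λ v → enc (U v) ≡ p))
      (M : ℕ) (N≤M : N ≤ M) (U-separated : Separated Last (enc ∘ U) M)
      where

      -- A bounded colour can only be `k`, the single coordinate that changes. The last colour is
      -- impossible: edges from the class of `n` back to that of `m` ascend and so have the last
      -- colour, and separation forbids late edges of that colour in both directions.
      descending⇒Bounded : ∀ {m n} → M ≤ m → M ≤ n → ∀ k → U m k Fin.> U n k →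
        (∀ k′ → k′ ≢ k → U m k′ ≡ U n k′) → Bounded k m n
      descending⇒Bounded {m} {n} M≤m M≤n k desc agree
        with Last-or-Bounded {m} {n} (λ { refl → <-irrefl refl desc })
      ... | inj₂ (k′ , mn) with k′ Fin.≟ k
      ...   | yes refl = mn
      ...   | no  k′≢k = contradiction (agree k′ k′≢k) (U-proper (≤-trans N≤M M≤m) (≤-trans N≤M M≤n) mn)
      descending⇒Bounded {m} {n} M≤m M≤n k desc agree | inj₁ last
        with U-separated (enc (U m)) (enc (U n)) (λ eq →
               <-irrefl (cong Fin.toℕ (sym (enc-injective eq k))) desc)
      ... | inj₁ none = contradiction last (none m n M≤m M≤n refl refl)
      ... | inj₂ none
        -- Cofinality supplies a late ascending edge from the class of `n` to that of `m`, against
        -- `none`.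
        with a , M≤a , a∈ ← U-cofinal (enc (U n)) M
        with b , M≤b , b∈ ← U-cofinal (enc (U m)) M
        = contradiction (ascending⇒Last (≤-trans N≤M M≤a) (≤-trans N≤M M≤b) a≢b asc)
                        (none a b M≤a M≤b a∈ b∈)
        where
        a≡n = enc-injective a∈
        b≡m = enc-injective b∈
        a≢b : a ≢ b
        a≢b refl = <-irrefl (cong Fin.toℕ (trans (sym (a≡n k)) (b≡m k))) desc
        asc : ∀ k′ → U a k′ Fin.≤ U b k′
        asc k′ with k′ Fin.≟ k
        ... | yes refl = subst₂ Fin._≤_ (sym (a≡n k)) (sym (b≡m k)) (<⇒≤ desc)
        ... | no  k′≢k = ≤-reflexive (cong Fin.toℕ
                           (trans (a≡n k′) (trans (sym (agree k′ k′≢k)) (sym (b≡m k′)))))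

      slide-agrees : ∀ m n (m≢n : m ≢ n) → SlideEdge U m n → M ≤ m → M ≤ n →
                     c m n m≢n ≡ cubeColouring U m n m≢n
      slide-agrees m n m≢n (_ , inj₁ (k , desc , agree)) M≤m M≤n =
        trans (proj₂ (descending⇒Bounded M≤m M≤n k desc agree))
              (sym (cubeColouring-descending U m≢n k desc agree))
      slide-agrees m n m≢n (_ , inj₂ asc) M≤m M≤n =
        trans (proj₂ (ascending⇒Last (≤-trans N≤M M≤m) (≤-trans N≤M M≤n) m≢n asc))
              (sym (cubeColouring-ascending U m≢n asc))

    module U-Classes = Classes U N U-proper

    -- `class U t` and the class with code `enc t` have the same members but are different
    -- predicates, so both bounds are transported along inclusions with threshold 0.
    class-density : ∀ t → UpperDensityEquals em (class U t) (+ 1 ℚ./ suc Q)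
    class-density t =
      Small⇒atMost em (suc Q) (Small-⊆ em (suc Q) (class U t) (U-Classes.Class (enc t)) 0
        (λ v _ → enc-cong) (U-Classes.Class-Small (enc t))) ,
      atLeast em (suc Q) λ q → let M , h = U-Classes.Class-lower-bound (enc t) q in
        M , λ n M≤n → ≤-trans (h n M≤n) (*-monoˡ-≤ (suc Q) (+-monoˡ-≤ (suc n) (*-monoˡ-≤ q
          (initialCount-⊆ em (U-Classes.Class (enc t)) (class U t) 0 (λ v _ → enc-injective) n))))

    slide-agrees-eventually : ∃[ M ] (∀ m n (m≢n : m ≢ n) → SlideEdge U m n → M ≤ m → M ≤ n →
                                      c m n m≢n ≡ cubeColouring U m n m≢n)
    slide-agrees-eventually = let M , sep = U-Classes.separated in
      N ⊔ M , slide-agrees U-Classes.Class-cofinal (N ⊔ M) (m≤m⊔n N M)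
        (Separated-mono (m≤n⊔m N M) sep)

  cube-structure-suc : Σ[ U ∈ CubePartition ℓ ]
    (∀ t → UpperDensityEquals em (class U t) (+ 1 ℚ./ suc Q)) ×
    Σ[ F ∈ List Vertex ]
      (∀ m n (m≢n : m ≢ n) → SlideEdge U m n → m ∉ F → n ∉ F →
        c m n m≢n ≡ cubeColouring U m n m≢n)
  cube-structure-suc =
    let N , U , U-descends = descending-partition
        M , agrees = Slide.slide-agrees-eventually U N U-descends
    in U , Slide.class-density U N U-descends , upTo M , λ m n m≢n edge m∉F n∉F →
       agrees m n m≢n edge (≮⇒≥ (m∉F ∘ ∈-upTo⁺)) (≮⇒≥ (n∉F ∘ ∈-upTo⁺))

module _ (em : ExcludedMiddle 0ℓ) {r} {ℓ : Fin r → ℕ} (c : EdgeColouring (Colour r)) where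

  -- `P` is a variable because `Π ℓ` does not reduce to a successor, whereas matching on `P` exposes
  -- the form `suc Q` used in counting.
  cube-structure : (∀ i → ¬ FinitePath (EdgeOfColour c (boundedColour i)) (ℓ i)) →
    ∀ P .{{_ : NonZero P}} (enc : Index ℓ → Fin P) →
    (∀ {s t} → (∀ k → s k ≡ t k) → enc s ≡ enc t) →
    (∀ {s t} → enc s ≡ enc t → ∀ k → s k ≡ t k) →
    (∀ (p : DirectedPath (EdgeOfColour c (lastColour r))) →
      UpperDensityAtMost em (vertexSet p) (+ 1 ℚ./ P)) →
    Σ[ U ∈ CubePartition ℓ ]
      (∀ t → UpperDensityEquals em (class U t) (+ 1 ℚ./ P)) ×
      Σ[ F ∈ List Vertex ]
        (∀ m n (m≢n : m ≢ n) → SlideEdge U m n → m ∉ F → n ∉ F →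
          c m n m≢n ≡ cubeColouring U m n m≢n)
  cube-structure short (suc Q) enc enc-cong enc-injective thin =
    Structure.cube-structure-suc em c short Q enc enc-cong enc-injective
      (λ p → atMost⇒Small em (suc Q) {vertexSet (infinite p)} (thin (infinite p)))

theorem4p2 : (em : ExcludedMiddle 0ℓ) →
    ∀ (r : ℕ) → r ≥ 1 →
    (ℓ : Fin r → ℕ) (ℓ≢0 : ∀ k → NonZero (ℓ k)) →
    (c : EdgeColouring (Colour r)) →
    (∀ (i : Fin r) → ¬ FinitePath (EdgeOfColour c (boundedColour i)) (ℓ i)) →
    (∀ (P : DirectedPath (EdgeOfColour c (lastColour r))) →
    UpperDensityAtMost em (vertexSet P) (productOfReciprocals ℓ ℓ≢0)) →
    Σ[ U ∈ CubePartition ℓ ]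
    (∀ (t : Index ℓ) →
    UpperDensityEquals em (class U t) (productOfReciprocals ℓ ℓ≢0)) ×
    Σ[ F ∈ List Vertex ]
    (∀ (m n : Vertex) (m≢n : m ≢ n) → SlideEdge U m n → m ∉ F → n ∉ F →
    c m n m≢n ≡ cubeColouring U m n m≢n)
theorem4p2 em r r≥1 ℓ ℓ≢0 c short thin
  rewrite productOfReciprocals≡1/Π ℓ ℓ≢0 =
  cube-structure em c short (Π ℓ) {{Π-nonZero ℓ ℓ≢0}} (encode ℓ) (encode-cong ℓ) (encode-injective ℓ) thin
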